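{- Let $n \in \mathbb{N}^*$, $d \in \mathbb{N}$, let $a_j < b_j$ be real numbers for $j=1,\dots,n$, and let $\mathcal{P} = \{p_1,\dots,p_m\} \subset \mathbb{R}[x_1,\dots,x_n]$ be a set of polynomials with $\deg(p_i) \le d$ for all $i$. For every polynomial $f \in \mathbb{R}[x_1,\dots,x_n]$ which is nonnegative on the constrained hypercube $\mathcal{H}_{\mathcal{P}}$ there exists a degree $n+d$ SONC certificate.
   Context: $\mathbb{N}$ contains $0$, $\mathbb{N}^* = \mathbb{N}\setminus\{0\}$, and $[n]=\{1,\dots,n\}$. A circuit polynomial is a polynomial $f(\mathbf{x}) = \sum_{j=0}^r f_{\boldsymbol{\alpha}(j)} \mathbf{x}^{\boldsymbol{\alpha}(j)} + f_{\boldsymbol{\beta}} \mathbf{x}^{\boldsymbol{\beta}}$ in $\mathbb{R}[x_1,\dots,x_n]$ with $r \le n$, exponents $\boldsymbol{\alpha}(j),\boldsymbol{\beta} \in \mathbb{N}^n$, $f_{\boldsymbol{\alpha}(j)} > 0$, $f_{\boldsymbol{\beta}} \in \mathbb{R}$, such that the Newton polytope of $f$ is a simplex with vertices $\boldsymbol{\alpha}(0),\dots,\boldsymbol{\alpha}(r) \in (2\mathbb{N})^n$ and $\boldsymbol{\beta}$ lies in the (relative) interior of this simplex. Monomial squares $c\,\mathbf{x}^{\boldsymbol{\alpha}}$ with $c>0$ and $\boldsymbol{\alpha} \in (2\mathbb{N})^n$ count as nonnegative circuit polynomials. A circuit polynomial is nonnegative if it is nonnegative on all of $\mathbb{R}^n$.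 A SONC polynomial is a finite sum $\sum_i \mu_i q_i$ with $\mu_i \ge 0$ and $q_i$ nonnegative circuit polynomials. Let $g_j(\mathbf{x}) = (x_j-a_j)(x_j-b_j)$ for $j \in [n]$, and $$\mathcal{H}_{\mathcal{P}} = \{\mathbf{x} \in \mathbb{R}^n : g_j(\mathbf{x}) = 0 \text{ for } j \in [n],\ p(\mathbf{x}) \ge 0 \text{ for } p \in \mathcal{P}\},$$ the hypercube $\prod_{j=1}^n \{a_j,b_j\}$ constrained by $\mathcal{P}$. It is described by the inequality constraints $\pm g_j \ge 0$, the box constraints $x_j - a_j \ge 0$, $b_j - x_j \ge 0$ ($j \in [n]$), and $p_i \ge 0$ ($i\in[m]$). A degree $D$ SONC certificate for $f$ (on $\mathcal{H}_{\mathcal{P}}$) is a decomposition, for some $q \in \mathbb{N}^*$, $$f(\mathbf{x}) = \sum_{\text{finite}} s(\mathbf{x}) H^{(q)}(\mathbf{x}),$$ where each $s$ is a SONC polynomial, each $H^{(q)}$ is a product of $q$ polynomials from $\{1,\ \pm g_j,\ x_j-a_j,\ b_j-x_j,\ p_i : j\in[n],\ i\in[m]\}$, and $\deg\left(\sum_{\text{finite}} s(\mathbf{x}) H^{(q)}(\mathbf{x})\right) \le D$.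
   Formalization: The formal theorem adds the hypothesis deg(f) ≤ n+d: a degree n+d certificate is an identity f = Σ s·H with deg(Σ s·H) ≤ n+d, so no f of larger degree has one (e.g. n=1, d=0, no constraints, f=x^4). -}

module Defs where

open import Level using (0ℓ; suc)
open import Algebra.Bundles using (CommutativeRing; Semiring)
import Algebra.Definitions as AlgebraDefinitions
import Algebra.Definitions.RawSemiring as RawSemiringDefinitions
open import Data.Bool.Base using (if_then_else_)
open import Data.Fin.Base using (Fin)
open import Data.List.Base as List using (List; []; _∷_; _++_; cartesianProductWith)
open import Data.Nat.Base as ℕ using (ℕ)
import Data.Nat.Properties as ℕ
open import Data.Nat.Divisibility using (_∣_)
open import Data.Product.Base using (Σ; ∃; ∃-syntax; _×_; _,_)
open import Data.Sum.Base using (_⊎_)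
open import Data.Vec.Base as Vec using (Vec; lookup; _[_]≔_)
open import Data.Vec.Properties using (≡-dec)
open import Data.Vec.Functional as Vector using (Vector)
open import Function.Bundles using (_⇔_)
open import Relation.Binary.Core using (Rel)
open import Relation.Binary.Definitions using (DecidableEquality)
open import Relation.Binary.Structures using (IsDecTotalOrder)
open import Relation.Nullary.Decidable.Core using (does)
open import Relation.Nullary.Negation.Core using (¬_)
open import Relation.Unary using (Pred; _∈_)

-- The real numbers, axiomatised as a Dedekind-complete ordered field.
-- Classically such a field exists and is unique up to isomorphism.  The
-- reals are the classical ones, so their equality and order are decidable
-- (which no constructive construction of the reals provides).
record RealField : Set (suc 0ℓ) where
  infix 4 _≤_ _<_
  field
    commutativeRing : CommutativeRing 0ℓ 0ℓ

  open CommutativeRing commutativeRing public renaming (Carrier to ℝ)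
  open AlgebraDefinitions _≈_ using (Invertible)

  field
    _≤_             : Rel ℝ 0ℓ
    isDecTotalOrder : IsDecTotalOrder _≈_ _≤_
    1≉0             : ¬ (1# ≈ 0#)
    inverse         : ∀ {x} → ¬ (x ≈ 0#) → Invertible 1# _*_ x
    +-monoʳ-≤       : ∀ x {y z} → y ≤ z → x + y ≤ x + z
    *-nonNeg        : ∀ {x y} → 0# ≤ x → 0# ≤ y → 0# ≤ x * y

  UpperBound : Pred ℝ 0ℓ → Pred ℝ 0ℓ
  UpperBound S u = ∀ x → x ∈ S → x ≤ u

  field
    complete : (S : Pred ℝ 0ℓ) → ∃ S → ∃ (UpperBound S) →
               ∃[ s ] (UpperBound S s × (∀ u → UpperBound S u → s ≤ u))

  _<_ : Rel ℝ 0ℓ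
  x < y = x ≤ y × ¬ (x ≈ y)

module SONC (R : RealField) where

  open RealField R
  open RawSemiringDefinitions (Semiring.rawSemiring semiring) using (sum; product; _^_)
    renaming (_×_ to _times_)

  Exponent : ℕ → Set
  Exponent n = Vec ℕ n

  Point : ℕ → Set
  Point n = Vector ℝ n

  _≟ᴱ_ : ∀ {n} → DecidableEquality (Exponent n)
  _≟ᴱ_ = ≡-dec ℕ._≟_

  -- ℝ[x₁,…,xₙ]: finite formal sums of terms c · x^α, in which an exponent
  -- may occur repeatedly and coefficients may vanish; two such sums are the
  -- same polynomial when all their (collected) coefficients agree.

  Poly : ℕ → Set
  Poly n = List (ℝ × Exponent n)

  coeff : ∀ {n} → Poly n → Exponent n → ℝ
  coeff []            α = 0#
  coeff ((c , β) ∷ p) α = (if does (β ≟ᴱ α) then c else 0#) + coeff p α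

  infix 4 _≈ᴾ_
  _≈ᴾ_ : ∀ {n} → Rel (Poly n) 0ℓ
  p ≈ᴾ q = ∀ α → coeff p α ≈ coeff q α

  infixl 6 _+ᴾ_ _-ᴾ_
  infixl 7 _*ᴾ_
  infix  8 -ᴾ_

  monomial : ∀ {n} → ℝ → Exponent n → Poly n
  monomial c α = (c , α) ∷ []

  const : ∀ {n} → ℝ → Poly n
  const {n} c = monomial c (Vec.replicate n 0)

  var : ∀ {n} → Fin n → Poly n
  var {n} j = monomial 1# (Vec.replicate n 0 [ j ]≔ 1)

  _+ᴾ_ : ∀ {n} → Poly n → Poly n → Poly n
  _+ᴾ_ = _++_

  _*ᴾ_ : ∀ {n} → Poly n → Poly n → Poly n
  _*ᴾ_ = cartesianProductWith λ (c , α) (d , β) → c * d , Vec.zipWith ℕ._+_ α β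

  -ᴾ_ : ∀ {n} → Poly n → Poly n
  -ᴾ_ = List.map λ (c , α) → - c , α

  _-ᴾ_ : ∀ {n} → Poly n → Poly n → Poly n
  p -ᴾ q = p +ᴾ -ᴾ q

  sumᴾ : ∀ {n k} → Vector (Poly n) k → Poly n
  sumᴾ = Vector.foldr _+ᴾ_ []

  productᴾ : ∀ {n k} → Vector (Poly n) k → Poly n
  productᴾ = Vector.foldr _*ᴾ_ (const 1#)

  eval : ∀ {n} → Poly n → Point n → ℝ
  eval []            x = 0#
  eval ((c , α) ∷ p) x = c * product (λ i → x i ^ lookup α i) + eval p x

  -- deg p ≤ D, where deg 0 = -∞.
  Degree≤ : ∀ {n} → ℕ → Poly n → Set
  Degree≤ D p = ∀ α → ¬ (coeff p α ≈ 0#) → Vec.sum α ℕ.≤ D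

  infix 4 _≈ⱽ_
  _≈ⱽ_ : ∀ {n} → Rel (Point n) 0ℓ
  x ≈ⱽ y = ∀ i → x i ≈ y i

  toPoint : ∀ {n} → Exponent n → Point n
  toPoint α i = lookup α i times 1#

  combination : ∀ {n k} → Vector ℝ k → Vector (Point n) k → Point n
  combination w v i = sum (λ j → w j * v j i)

  ConvexHull : ∀ {n} → Pred (Point n) 0ℓ → Pred (Point n) 0ℓ
  ConvexHull S x =
    ∃[ k ] Σ (Vector ℝ k) λ w → Σ (Vector (Point _) k) λ v →
      (∀ j → v j ∈ S) × (∀ j → 0# ≤ w j) × sum w ≈ 1# × x ≈ⱽ combination w v

  NewtonPolytope : ∀ {n} → Poly n → Pred (Point n) 0ℓ
  NewtonPolytope f =
    ConvexHull λ x → ∃[ α ] (¬ (coeff f α ≈ 0#) × x ≈ⱽ toPoint α)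

  AffinelyIndependent : ∀ {n k} → Vector (Point n) k → Set
  AffinelyIndependent v =
    ∀ w → sum w ≈ 0# → combination w v ≈ⱽ (λ _ → 0#) → ∀ j → w j ≈ 0#

  -- For affinely independent v: the simplex with vertex set v, and its
  -- relative interior (all barycentric coordinates positive; for a single
  -- vertex this is the vertex itself).
  Simplex : ∀ {n k} → Vector (Point n) k → Pred (Point n) 0ℓ
  Simplex v = ConvexHull λ x → ∃[ j ] x ≈ⱽ v j

  SimplexInterior : ∀ {n k} → Vector (Point n) k → Pred (Point n) 0ℓ
  SimplexInterior v x =
    ∃[ w ] ((∀ j → 0# < w j) × sum w ≈ 1# × x ≈ⱽ combination w v)

  EvenExponent : ∀ {n} → Exponent n → Set
  EvenExponent α = ∀ i → 2 ∣ lookup α i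

  record IsCircuit {n} (f : Poly n) : Set where
    field
      r        : ℕ
      r≤n      : r ℕ.≤ n
      α        : Vector (Exponent n) (ℕ.suc r)
      β        : Exponent n
      fα       : Vector ℝ (ℕ.suc r)
      fβ       : ℝ
      fα-pos   : ∀ j → 0# < fα j
      f≈       : f ≈ᴾ sumᴾ (λ j → monomial (fα j) (α j)) +ᴾ monomial fβ β
      α-even   : ∀ j → EvenExponent (α j)
      α-indep  : AffinelyIndependent (λ j → toPoint (α j))
      newton   : ∀ x → x ∈ NewtonPolytope f ⇔ x ∈ Simplex (λ j → toPoint (α j))
      interior : toPoint β ∈ SimplexInterior (λ j → toPoint (α j))

  IsMonomialSquare : ∀ {n} → Poly n → Set
  IsMonomialSquare f =
    ∃[ c ] ∃[ α ] (0# < c × EvenExponent α × f ≈ᴾ monomial c α)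

  IsNonNegCircuit : ∀ {n} → Poly n → Set
  IsNonNegCircuit f =
    (IsCircuit f × (∀ x → 0# ≤ eval f x)) ⊎ IsMonomialSquare f

  IsSONC : ∀ {n} → Poly n → Set
  IsSONC {n} f =
    ∃[ k ] Σ (Vector ℝ k) λ μ → Σ (Vector (Poly n) k) λ q →
      (∀ i → 0# ≤ μ i) × (∀ i → IsNonNegCircuit (q i)) ×
      f ≈ᴾ sumᴾ (λ i → const (μ i) *ᴾ q i)

  module Hypercube {n m : ℕ} (a b : Vector ℝ n) (p : Vector (Poly n) m) where

    g : Fin n → Poly n
    g j = (var j -ᴾ const (a j)) *ᴾ (var j -ᴾ const (b j))

    ConstrainedHypercube : Pred (Point n) 0ℓ
    ConstrainedHypercube x =
      (∀ j → eval (g j) x ≈ 0#) × (∀ i → 0# ≤ eval (p i) x)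

    data Constraint : Set where
      one                   : Constraint
      +g -g x-lower upper-x : Fin n → Constraint
      given                 : Fin m → Constraint

    constraint : Constraint → Poly n
    constraint one         = const 1#
    constraint (+g j)      = g j
    constraint (-g j)      = -ᴾ g j
    constraint (x-lower j) = var j -ᴾ const (a j)
    constraint (upper-x j) = const (b j) -ᴾ var j
    constraint (given i)   = p i

    -- As f equals the sum, degree-sum says no more than deg f ≤ D (so only
    -- such f can have a certificate of degree D); degree-summand is what
    -- bounds the certificate, forbidding high-degree summands that cancel.
    record SONCCertificate (D : ℕ) (f : Poly n) : Set where
      field
        q       : ℕ
        q≥1     : 1 ℕ.≤ q
        k       : ℕ
        s       : Vector (Poly n) k
        s-SONC  : ∀ t → IsSONC (s t)
        factors : Vector (Vector Constraint q) k

      H : Vector (Poly n) k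
      H t = productᴾ (λ l → constraint (factors t l))

      summand : Vector (Poly n) k
      summand t = s t *ᴾ H t

      field
        f≈             : f ≈ᴾ sumᴾ summand
        degree-sum     : Degree≤ D (sumᴾ summand)
        degree-summand : ∀ t → Degree≤ D (summand t)

module Submission where

-- For a vertex v of the box let δᵥ be the product of n linear factors that is
-- 1 at v and 0 at the other vertices.  Call a polynomial negligible if all its
-- real multiples have a certificate of degree D = n + d.  Every gⱼ h with
-- deg h ≤ D - 2 is negligible, so rewriting xⱼ² as gⱼ + (aⱼ + bⱼ) xⱼ - aⱼ bⱼ
-- shows that a polynomial f of degree ≤ D is Σᵥ f(v) δᵥ up to a negligible one:
-- multilinear polynomials are equal to their interpolant.  If f(v) ≥ 0, then
-- f(v) δᵥ is a nonnegative multiple of a product of n box constraints.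
-- Otherwise pᵢ(v) < 0 for some i, and f(v) δᵥ agrees with (f(v) / pᵢ(v)) δᵥ pᵢ
-- up to a negligible polynomial, as both have the same values on the vertices.

open import Defs
open import Algebra.Bundles using (CommutativeSemiring)
open import Data.Bool.Base using (Bool; true; false; if_then_else_)
open import Data.Fin.Base using (Fin; zero; suc)
open import Data.Nat.Base as ℕ using (ℕ; zero; suc)
open import Data.Product.Base using (∃-syntax; _×_; _,_; proj₁; proj₂)
open import Data.Vec.Base as Vec using (Vec; []; _∷_; lookup; _[_]≔_)
import Data.Bool.Properties as Bool
import Data.Vec.Properties as Vec
import Data.Nat.Properties as ℕ
open import Data.Vec.Functional as Vector using (Vector)
open import Function.Base using (_∘_; case_of_)
open import Relation.Binary.PropositionalEquality.Core as ≡ using (_≡_; _≢_)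
open import Relation.Nullary.Negation.Core using (¬_; contradiction)
open import Relation.Binary.Structures using (IsEquivalence)
open import Relation.Unary using (_∈_)

-- All SONC multipliers of the certificate are nonnegative constants; the work is done by the
-- products of constraints. The obstacle is `g j` times a polynomial h: the monomials of h may be
-- odd and its coefficients negative, so h is in general no SONC polynomial. Written in the
-- `xᵢ - aᵢ`, h becomes a linear combination of products of constraints of no larger degree, and a
-- negative coefficient is absorbed by passing from `g j` to its negative, which is a constraint
-- too. The bound n + d is the degree allowed for δᵥ pᵢ, the product that an infeasible vertex calls
-- for. The reduction of a polynomial to its values at the vertices never raises degrees, so it
-- stays below the same bound. The number of factors is controlled separately from the degree, since
-- a constant pᵢ is a factor that adds no degree.

module Exponents where

  -- Exponent vectors.

  infixl 6 _⊞_
  _⊞_ : ∀ {n} → Vec ℕ n → Vec ℕ n → Vec ℕ n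
  _⊞_ = Vec.zipWith ℕ._+_

  𝟎 : ∀ {n} → Vec ℕ n
  𝟎 {n} = Vec.replicate n 0

  unit : ∀ {n} → Fin n → Vec ℕ n
  unit {n} i = 𝟎 [ i ]≔ 1

  ⊞-identityˡ : ∀ {n} (α : Vec ℕ n) → 𝟎 ⊞ α ≡ α
  ⊞-identityˡ = Vec.zipWith-identityˡ ℕ.+-identityˡ

  ⊞-comm : ∀ {n} (α β : Vec ℕ n) → α ⊞ β ≡ β ⊞ α
  ⊞-comm = Vec.zipWith-comm ℕ.+-comm

  ⊞-assoc : ∀ {n} (α β γ : Vec ℕ n) → (α ⊞ β) ⊞ γ ≡ α ⊞ (β ⊞ γ)
  ⊞-assoc = Vec.zipWith-assoc ℕ.+-assoc

  ∣_∣ : ∀ {n} → Vec ℕ n → ℕ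
  ∣_∣ = Vec.sum

  ∣𝟎∣ : ∀ n → ∣ 𝟎 {n} ∣ ≡ 0
  ∣𝟎∣ zero    = ≡.refl
  ∣𝟎∣ (suc n) = ∣𝟎∣ n

  ∣unit∣ : ∀ {n} (i : Fin n) → ∣ unit i ∣ ≡ 1
  ∣unit∣ {suc n} zero = ≡.cong suc (∣𝟎∣ n)
  ∣unit∣ (suc i)      = ∣unit∣ i

  ∣⊞∣ : ∀ {n} (α β : Vec ℕ n) → ∣ α ⊞ β ∣ ≡ ∣ α ∣ ℕ.+ ∣ β ∣
  ∣⊞∣ []      []      = ≡.refl
  ∣⊞∣ (k ∷ α) (l ∷ β) = ≡.trans (≡.cong (k ℕ.+ l ℕ.+_) (∣⊞∣ α β)) (interchange k l ∣ α ∣ ∣ β ∣)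
    where open import Algebra.Properties.CommutativeSemigroup ℕ.+-commutativeSemigroup using (interchange)

  ∣unit⊞∣ : ∀ {n} (i : Fin n) α → ∣ unit i ⊞ α ∣ ≡ suc ∣ α ∣
  ∣unit⊞∣ i α = ≡.trans (∣⊞∣ (unit i) α) (≡.cong (ℕ._+ ∣ α ∣) (∣unit∣ i))

  unit⊞[]≔ : ∀ {n} (α : Vec ℕ n) i {k} → lookup α i ≡ suc k → α ≡ unit i ⊞ (α [ i ]≔ k)
  unit⊞[]≔ (_ ∷ α) zero    ≡.refl = ≡.cong (_ ∷_) (≡.sym (⊞-identityˡ α))
  unit⊞[]≔ (_ ∷ α) (suc i) eq     = ≡.cong (_ ∷_) (unit⊞[]≔ α i eq)

  -- The step adds one unit in any coordinate, so that for monomials it is multiplication by one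
  -- variable.
  exponent-induction : ∀ {n} (P : Vec ℕ n → Set) → P 𝟎 →
                       (∀ i α → P α → P (unit i ⊞ α)) → ∀ α → P α
  exponent-induction         P P0 step []      = P0
  exponent-induction {suc n} P P0 step (k ∷ α) = go k
    where
    go : ∀ k → P (k ∷ α)
    go zero    = exponent-induction (P ∘ (0 ∷_)) P0 (λ i β → step (suc i) (0 ∷ β)) α
    go (suc k) = ≡.subst (λ β → P (suc k ∷ β)) (⊞-identityˡ α) (step zero (k ∷ α) (go k))

open Exponents

-- Sums over the vertices of a cube, for real numbers and for polynomials alike.

module CubeSums {c ℓ} (S : CommutativeSemiring c ℓ) where

  open CommutativeSemiring S
  open import Algebra.Definitions.RawSemiring rawSemiring using (product; _^_)
  open import Algebra.Properties.Semiring.Exp semiring using (^-homo-*)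
  import Algebra.Properties.CommutativeMonoid.Sum *-commutativeMonoid as Product
  open import Algebra.Properties.CommutativeSemigroup
    (CommutativeSemiring.+-commutativeSemigroup S) using (interchange)

  product-cong : ∀ {n} {f g : Vector Carrier n} → (∀ i → f i ≈ g i) → product f ≈ product g
  product-cong = Product.sum-cong-≋

  product-* : ∀ {n} (f g : Vector Carrier n) → product (λ i → f i * g i) ≈ product f * product g
  product-* = Product.∑-distrib-+

  product-1 : ∀ {n} {f : Vector Carrier n} → (∀ i → f i ≈ 1#) → product f ≈ 1#
  product-1 {n} f≈1 = trans (product-cong f≈1) (Product.sum-replicate-zero n)

  product-0 : ∀ {n} {f : Vector Carrier n} i → f i ≈ 0# → product f ≈ 0#
  product-0 zero    f≈0 = trans (*-congʳ f≈0) (zeroˡ _)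
  product-0 (suc i) f≈0 = trans (*-congˡ (product-0 i f≈0)) (zeroʳ _)

  infixr 8 _^^_
  -- For a point `t` this is the value of a monomial; for `t = var`, in the semiring of polynomials,
  -- it is the monomial itself.
  _^^_ : ∀ {n} → Vector Carrier n → Vec ℕ n → Carrier
  t ^^ α = product (λ i → t i ^ lookup α i)

  ^^-𝟎 : ∀ {n} (t : Vector Carrier n) → t ^^ 𝟎 ≈ 1#
  ^^-𝟎 t = product-1 λ i → reflexive (≡.cong (t i ^_) (Vec.lookup-replicate i 0))

  ^^-⊞ : ∀ {n} (t : Vector Carrier n) α β → t ^^ (α ⊞ β) ≈ t ^^ α * t ^^ β
  ^^-⊞ t α β = trans
    (product-cong λ i → trans (reflexive (≡.cong (t i ^_) (Vec.lookup-zipWith ℕ._+_ i α β)))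
                              (^-homo-* (t i) (lookup α i) (lookup β i)))
    (product-* (λ i → t i ^ lookup α i) (λ i → t i ^ lookup β i))

  ^^-unit : ∀ {n} (t : Vector Carrier n) j → t ^^ unit j ≈ t j
  ^^-unit t zero    = trans (*-cong (*-identityʳ _) (^^-𝟎 (t ∘ suc))) (*-identityʳ _)
  ^^-unit t (suc j) = trans (*-identityˡ _) (^^-unit (t ∘ suc) j)

  cubeSum : ∀ n → (Vec Bool n → Carrier) → Carrier
  cubeSum zero    F = F []
  cubeSum (suc n) F = cubeSum n (F ∘ (false ∷_)) + cubeSum n (F ∘ (true ∷_))

  cubeSum-cong : ∀ n {F G} → (∀ v → F v ≈ G v) → cubeSum n F ≈ cubeSum n G
  cubeSum-cong zero    F≈G = F≈G []
  cubeSum-cong (suc n) F≈G = +-cong (cubeSum-cong n (F≈G ∘ (false ∷_))) (cubeSum-cong n (F≈G ∘ (true ∷_)))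

  cubeSum-+ : ∀ n F G → cubeSum n (λ v → F v + G v) ≈ cubeSum n F + cubeSum n G
  cubeSum-+ zero    F G = refl
  cubeSum-+ (suc n) F G = trans
    (+-cong (cubeSum-+ n (F ∘ (false ∷_)) (G ∘ (false ∷_))) (cubeSum-+ n (F ∘ (true ∷_)) (G ∘ (true ∷_))))
    (interchange _ _ _ _)

  cubeSum-*ˡ : ∀ n c F → cubeSum n (λ v → c * F v) ≈ c * cubeSum n F
  cubeSum-*ˡ zero    c F = refl
  cubeSum-*ˡ (suc n) c F = trans
    (+-cong (cubeSum-*ˡ n c (F ∘ (false ∷_))) (cubeSum-*ˡ n c (F ∘ (true ∷_))))
    (sym (distribˡ c _ _))

  cubeSum-0 : ∀ n {F} → (∀ v → F v ≈ 0#) → cubeSum n F ≈ 0#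
  cubeSum-0 zero    F≈0 = F≈0 []
  cubeSum-0 (suc n) F≈0 = trans
    (+-cong (cubeSum-0 n (F≈0 ∘ (false ∷_))) (cubeSum-0 n (F≈0 ∘ (true ∷_)))) (+-identityˡ 0#)

  cubeSum-single : ∀ n F v → (∀ u → u ≢ v → F u ≈ 0#) → cubeSum n F ≈ F v
  cubeSum-single zero    F []          F≈0 = refl
  cubeSum-single (suc n) F (false ∷ v) F≈0 = trans
    (+-cong (cubeSum-single n _ v (λ u u≢v → F≈0 (false ∷ u) (u≢v ∘ Vec.∷-injectiveʳ)))
            (cubeSum-0 n (λ u → F≈0 (true ∷ u) λ ())))
    (+-identityʳ _)
  cubeSum-single (suc n) F (true ∷ v) F≈0 = trans
    (+-cong (cubeSum-0 n (λ u → F≈0 (false ∷ u) λ ()))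
            (cubeSum-single n _ v (λ u u≢v → F≈0 (true ∷ u) (u≢v ∘ Vec.∷-injectiveʳ))))
    (+-identityˡ _)

  -- Distributivity, one coordinate at a time: `v` records which summand is taken from each factor.
  -- This turns a product of univariate interpolations into a sum over vertices.
  product-of-sums : ∀ {n} (Q : Fin n → Bool → Carrier) →
    product (λ i → Q i false + Q i true) ≈ cubeSum n (λ v → product (λ i → Q i (lookup v i)))
  product-of-sums {zero}  Q = refl
  product-of-sums {suc n} Q = trans (*-congˡ (product-of-sums (Q ∘ suc)))
    (trans (distribʳ _ _ _) (+-cong (sym (cubeSum-*ˡ n _ _)) (sym (cubeSum-*ˡ n _ _))))

-- The commutative semiring of polynomials.

module PolynomialSemiring (R : RealField) where

  open RealField R hiding (zero)
  open SONC R
  open import Algebra.Properties.Ring ring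
  open import Algebra.Properties.CommutativeSemigroup
    (CommutativeSemiring.+-commutativeSemigroup commutativeSemiring) using (interchange)
  open import Algebra.Properties.CommutativeSemigroup
    (CommutativeSemiring.*-commutativeSemigroup commutativeSemiring)
    using () renaming (x∙yz≈y∙xz to x*yz≈y*xz)
  open import Data.List.Base as List using (List; []; _∷_; _++_; length; filter)
  import Data.List.Properties as List
  open import Relation.Binary.Reasoning.Setoid setoid
  open import Relation.Nullary.Decidable using (does; yes; no; ¬?)
  open import Algebra.Structures.Biased using (isCommutativeSemiringˡ)

  -- The linear functional that takes the value `w α` on the monomial x^α. Coefficients are the case
  -- `w = indicator α`, evaluation at `x` the case `w = x ^^_`.
  φ : ∀ {n} → (Exponent n → ℝ) → Poly n → ℝ
  φ w []            = 0#
  φ w ((c , α) ∷ p) = c * w α + φ w p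

  φ-cong : ∀ {n} {w w′ : Exponent n → ℝ} p → (∀ α → w α ≈ w′ α) → φ w p ≈ φ w′ p
  φ-cong []            w≈ = refl
  φ-cong ((c , α) ∷ p) w≈ = +-cong (*-congˡ (w≈ α)) (φ-cong p w≈)

  φ-+ : ∀ {n} (w w′ : Exponent n → ℝ) p → φ (λ α → w α + w′ α) p ≈ φ w p + φ w′ p
  φ-+ w w′ []            = sym (+-identityˡ 0#)
  φ-+ w w′ ((c , α) ∷ p) = trans (+-cong (distribˡ c _ _) (φ-+ w w′ p)) (interchange _ _ _ _)

  φ-scale : ∀ {n} c (w : Exponent n → ℝ) p → φ (λ α → c * w α) p ≈ c * φ w p
  φ-scale c w []            = sym (zeroʳ c)
  φ-scale c w ((d , α) ∷ p) =
    trans (+-cong (x*yz≈y*xz d c (w α)) (φ-scale c w p)) (sym (distribˡ c _ _))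

  φ-0 : ∀ {n} {w : Exponent n → ℝ} p → (∀ α → w α ≈ 0#) → φ w p ≈ 0#
  φ-0 []            w≈0 = refl
  φ-0 ((c , α) ∷ p) w≈0 = trans
    (+-cong (trans (*-congˡ (w≈0 α)) (zeroʳ c)) (φ-0 p w≈0)) (+-identityˡ 0#)

  -- Interchange of two finite sums. With `k α β = w (α ⊞ β)` it yields commutativity of
  -- multiplication.
  φ-swap : ∀ {n} (k : Exponent n → Exponent n → ℝ) p q →
           φ (λ α → φ (k α) q) p ≈ φ (λ β → φ (λ α → k α β) p) q
  φ-swap k []            q = sym (φ-0 q (λ _ → refl))
  φ-swap k ((c , α) ∷ p) q = sym (trans
    (φ-+ (λ β → c * k α β) (λ β → φ (λ α → k α β) p) q)
    (+-cong (φ-scale c (k α) q) (sym (φ-swap k p q))))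

  φ-++ : ∀ {n} (w : Exponent n → ℝ) p q → φ w (p ++ q) ≈ φ w p + φ w q
  φ-++ w []      q = sym (+-identityˡ _)
  φ-++ w (x ∷ p) q = trans (+-congˡ (φ-++ w p q)) (sym (+-assoc _ _ _))

  φ-neg : ∀ {n} (w : Exponent n → ℝ) p → φ w (-ᴾ p) ≈ - φ w p
  φ-neg w []            = sym -0#≈0#
  φ-neg w ((c , α) ∷ p) = trans (+-cong (sym (-‿distribˡ-* c (w α))) (φ-neg w p)) (-‿+-comm _ _)

  φ-*ᴾ : ∀ {n} (w : Exponent n → ℝ) p q → φ w (p *ᴾ q) ≈ φ (λ α → φ (λ β → w (α ⊞ β)) q) p
  φ-*ᴾ w []            q = refl
  φ-*ᴾ w ((c , α) ∷ p) q = trans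
    (φ-++ w (List.map (λ (d , β) → c * d , α ⊞ β) q) (p *ᴾ q))
    (+-cong (row q) (φ-*ᴾ w p q))
    where
    row : ∀ q → φ w (List.map (λ (d , β) → c * d , α ⊞ β) q) ≈ c * φ (λ β → w (α ⊞ β)) q
    row []            = sym (zeroʳ c)
    row ((d , β) ∷ q) = trans (+-cong (*-assoc c d _) (row q)) (sym (distribˡ c _ _))

  -- Equality of polynomials as equality of all linear functionals: it turns
  -- the semiring laws into statements about iterated sums.
  infix 4 _≋_
  record _≋_ {n} (p q : Poly n) : Set where
    constructor mk≋
    field
      φ≈ : ∀ w → φ w p ≈ φ w q
  open _≋_ public

  indicator : ∀ {n} → Exponent n → Exponent n → ℝ
  indicator α β = if does (β ≟ᴱ α) then 1# else 0#

  coeff≈φ : ∀ {n} p (α : Exponent n) → coeff p α ≈ φ (indicator α) p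
  coeff≈φ []            α = refl
  coeff≈φ ((c , β) ∷ p) α = +-cong (term (does (β ≟ᴱ α))) (coeff≈φ p α)
    where
    term : ∀ b → (if b then c else 0#) ≈ c * (if b then 1# else 0#)
    term true  = sym (*-identityʳ c)
    term false = sym (zeroʳ c)

  without : ∀ {n} → Exponent n → Poly n → Poly n
  without α = filter (λ (_ , β) → ¬? (β ≟ᴱ α))

  φ-without : ∀ {n} (w : Exponent n → ℝ) α p → φ w p ≈ coeff p α * w α + φ w (without α p)
  φ-without w α []            = sym (trans (+-identityʳ _) (zeroˡ _))
  φ-without w α ((c , β) ∷ p) with β ≟ᴱ α
  ... | yes ≡.refl = trans (+-congˡ (φ-without w α p))
                       (trans (sym (+-assoc _ _ _)) (+-congʳ (sym (distribʳ _ _ _))))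
  ... | no  _      = trans (+-congˡ (φ-without w α p)) (trans (x∙yz≈y∙xz _ _ _)
                       (+-congʳ (*-congʳ (sym (+-identityˡ _)))))
    where
    open import Algebra.Properties.CommutativeSemigroup
      (CommutativeSemiring.+-commutativeSemigroup commutativeSemiring) using (x∙yz≈y∙xz)

  -- All terms with the exponent of the first one are collected; their coefficients sum to 0, and
  -- fewer terms remain. The remaining list is not a sublist by structure, so the recursion runs on
  -- a bound `k` for the length.
  φ-annihilates : ∀ {n} k (p : Poly n) → length p ℕ.≤ k → p ≈ᴾ [] → ∀ w → φ w p ≈ 0#
  φ-annihilates k       []            _           p≈0 w = refl
  φ-annihilates (suc k) ((c , α) ∷ p) (ℕ.s≤s len) p≈0 w = begin
    φ w ((c , α) ∷ p)                          ≈⟨ split w ⟩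
    (c + coeff p α) * w α + φ w (without α p)  ≈⟨ +-cong (*-congʳ c+coeff≈0) (φ-annihilates k (without α p) len′ rest≈0 w) ⟩
    0# * w α + 0#                              ≈⟨ trans (+-identityʳ _) (zeroˡ _) ⟩
    0#                                         ∎
    where
    len′ : length (without α p) ℕ.≤ k
    len′ = ℕ.≤-trans (List.length-filter _ p) len

    c+coeff≈0 : c + coeff p α ≈ 0#
    c+coeff≈0 with α ≟ᴱ α | p≈0 α
    ... | yes _   | eq = eq
    ... | no  α≢α | _  = contradiction ≡.refl α≢α

    split : ∀ w → φ w ((c , α) ∷ p) ≈ (c + coeff p α) * w α + φ w (without α p)
    split w = begin
      c * w α + φ w p                                  ≈⟨ +-congˡ (φ-without w α p) ⟩
      c * w α + (coeff p α * w α + φ w (without α p))  ≈⟨ +-assoc _ _ _ ⟨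
      c * w α + coeff p α * w α + φ w (without α p)    ≈⟨ +-congʳ (sym (distribʳ _ _ _)) ⟩
      (c + coeff p α) * w α + φ w (without α p)        ∎

    -- `split` holds for every functional, in particular for the one reading off the coefficient at
    -- β; the collected term contributes 0 to it.
    rest≈0 : without α p ≈ᴾ []
    rest≈0 β = begin
      coeff (without α p) β                              ≈⟨ coeff≈φ (without α p) β ⟩
      φ (indicator β) (without α p)                      ≈⟨ +-identityˡ _ ⟨
      0# + φ (indicator β) (without α p)                 ≈⟨ +-congʳ (trans (*-congʳ c+coeff≈0) (zeroˡ _)) ⟨
      (c + coeff p α) * indicator β α + φ (indicator β) (without α p) ≈⟨ split (indicator β) ⟨
      φ (indicator β) ((c , α) ∷ p)                      ≈⟨ coeff≈φ ((c , α) ∷ p) β ⟨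
      coeff ((c , α) ∷ p) β                              ≈⟨ p≈0 β ⟩
      0#                                                 ∎

  ≋⇒≈ᴾ : ∀ {n} {p q : Poly n} → p ≋ q → p ≈ᴾ q
  ≋⇒≈ᴾ {p = p} {q} p≋q α = trans (coeff≈φ p α) (trans (φ≈ p≋q (indicator α)) (sym (coeff≈φ q α)))

  -- By linearity only the difference matters, and all its coefficients vanish.
  ≈ᴾ⇒≋ : ∀ {n} {p q : Poly n} → p ≈ᴾ q → p ≋ q
  ≈ᴾ⇒≋ {p = p} {q} p≈q = mk≋ λ w → x∙y⁻¹≈ε⇒x≈y _ _
    (trans (sym (φ-− w)) (φ-annihilates _ (p -ᴾ q) ℕ.≤-refl diff≈0 w))
    where
    φ-− : ∀ w → φ w (p -ᴾ q) ≈ φ w p - φ w q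
    φ-− w = trans (φ-++ w p (-ᴾ q)) (+-congˡ (φ-neg w q))

    diff≈0 : p -ᴾ q ≈ᴾ []
    diff≈0 α = trans (coeff≈φ (p -ᴾ q) α) (trans (φ-− (indicator α))
      (x≈y⇒x∙y⁻¹≈ε (trans (sym (coeff≈φ p α)) (trans (p≈q α) (coeff≈φ q α)))))

  -- Opaque, so that unification can invert them.
  infixl 6 _⊕_
  infixl 7 _⊗_
  opaque
    _⊕_ _⊗_ : ∀ {n} → Poly n → Poly n → Poly n
    _⊕_ = _+ᴾ_
    _⊗_ = _*ᴾ_

    ⊕≡+ᴾ : ∀ {n} (p q : Poly n) → p ⊕ q ≡ p +ᴾ q
    ⊕≡+ᴾ p q = ≡.refl

    ⊗≡*ᴾ : ∀ {n} (p q : Poly n) → p ⊗ q ≡ p *ᴾ q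
    ⊗≡*ᴾ p q = ≡.refl

    φ-⊕ : ∀ {n} (w : Exponent n → ℝ) p q → φ w (p ⊕ q) ≈ φ w p + φ w q
    φ-⊕ = φ-++

    φ-⊗ : ∀ {n} (w : Exponent n → ℝ) p q → φ w (p ⊗ q) ≈ φ (λ α → φ (λ β → w (α ⊞ β)) q) p
    φ-⊗ = φ-*ᴾ

  φ-const : ∀ {n} (w : Exponent n → ℝ) c → φ w (const c) ≈ c * w 𝟎
  φ-const w c = +-identityʳ _

  polynomialSemiring : ℕ → CommutativeSemiring _ _
  polynomialSemiring n = record
    { Carrier = Poly n
    ; _≈_     = _≋_
    ; _+_     = _⊕_
    ; _*_     = _⊗_
    ; 0#      = []
    ; 1#      = const 1#
    ; isCommutativeSemiring = isCommutativeSemiringˡ record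
      { +-isCommutativeMonoid = record
        { isMonoid = record
          { isSemigroup = record
            { isMagma = record
              { isEquivalence = isEquivalence≋
              ; ∙-cong = λ {p} {q} {r} {s} p≋q r≋s → mk≋ λ w →
                  trans (φ-⊕ w p r) (trans (+-cong (φ≈ p≋q w) (φ≈ r≋s w)) (sym (φ-⊕ w q s))) }
            ; assoc = λ p q r → mk≋ λ w → begin
                φ w (p ⊕ q ⊕ r)          ≈⟨ φ-⊕ w (p ⊕ q) r ⟩
                φ w (p ⊕ q) + φ w r      ≈⟨ +-congʳ (φ-⊕ w p q) ⟩
                φ w p + φ w q + φ w r    ≈⟨ +-assoc _ _ _ ⟩
                φ w p + (φ w q + φ w r)  ≈⟨ +-congˡ (φ-⊕ w q r) ⟨
                φ w p + φ w (q ⊕ r)      ≈⟨ φ-⊕ w p (q ⊕ r) ⟨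
                φ w (p ⊕ (q ⊕ r))        ∎ }
          ; identity = (λ p → mk≋ λ w → trans (φ-⊕ w [] p) (+-identityˡ _))
                     , (λ p → mk≋ λ w → trans (φ-⊕ w p []) (+-identityʳ _)) }
        ; comm = λ p q → mk≋ λ w → trans (φ-⊕ w p q) (trans (+-comm _ _) (sym (φ-⊕ w q p))) }
      ; *-isCommutativeMonoid = record
        { isMonoid = record
          { isSemigroup = record
            { isMagma = record
              { isEquivalence = isEquivalence≋
              ; ∙-cong = λ {p} {q} {r} {s} p≋q r≋s → mk≋ λ w → begin
                  φ w (p ⊗ r)                            ≈⟨ φ-⊗ w p r ⟩
                  φ (λ α → φ (λ β → w (α ⊞ β)) r) p      ≈⟨ φ≈ p≋q _ ⟩
                  φ (λ α → φ (λ β → w (α ⊞ β)) r) q      ≈⟨ φ-cong q (λ α → φ≈ r≋s _) ⟩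
                  φ (λ α → φ (λ β → w (α ⊞ β)) s) q      ≈⟨ φ-⊗ w q s ⟨
                  φ w (q ⊗ s)                            ∎ }
            ; assoc = λ p q r → mk≋ λ w → begin
                φ w (p ⊗ q ⊗ r)                                                  ≈⟨ φ-⊗ w (p ⊗ q) r ⟩
                φ (λ α → φ (λ γ → w (α ⊞ γ)) r) (p ⊗ q)                          ≈⟨ φ-⊗ _ p q ⟩
                φ (λ α → φ (λ β → φ (λ γ → w ((α ⊞ β) ⊞ γ)) r) q) p
                  ≈⟨ φ-cong p (λ α → φ-cong q λ β → φ-cong r λ γ → reflexive (≡.cong w (⊞-assoc α β γ))) ⟩
                φ (λ α → φ (λ β → φ (λ γ → w (α ⊞ (β ⊞ γ))) r) q) p              ≈⟨ φ-cong p (λ α → φ-⊗ (λ β → w (α ⊞ β)) q r) ⟨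
                φ (λ α → φ (λ β → w (α ⊞ β)) (q ⊗ r)) p                          ≈⟨ φ-⊗ w p (q ⊗ r) ⟨
                φ w (p ⊗ (q ⊗ r))                                                ∎ }
          ; identity = ⊗-identityˡ , λ p → mk≋ λ w →
              trans (φ≈ (⊗-comm p (const 1#)) w) (φ≈ (⊗-identityˡ p) w) }
        ; comm = ⊗-comm }
      ; distribʳ = λ p q r → mk≋ λ w → begin
          φ w ((q ⊕ r) ⊗ p)             ≈⟨ φ-⊗ w (q ⊕ r) p ⟩
          φ _ (q ⊕ r)                   ≈⟨ φ-⊕ _ q r ⟩
          φ _ q + φ _ r                 ≈⟨ +-cong (φ-⊗ w q p) (φ-⊗ w r p) ⟨
          φ w (q ⊗ p) + φ w (r ⊗ p)     ≈⟨ φ-⊕ w (q ⊗ p) (r ⊗ p) ⟨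
          φ w (q ⊗ p ⊕ r ⊗ p)           ∎
      ; zeroˡ = λ p → mk≋ λ w → φ-⊗ w [] p }
    }
    where
    isEquivalence≋ : IsEquivalence (_≋_ {n})
    isEquivalence≋ = record
      { refl  = mk≋ λ w → refl
      ; sym   = λ p≋q → mk≋ λ w → sym (φ≈ p≋q w)
      ; trans = λ p≋q q≋r → mk≋ λ w → trans (φ≈ p≋q w) (φ≈ q≋r w) }

    ⊗-comm : ∀ (p q : Poly n) → p ⊗ q ≋ q ⊗ p
    ⊗-comm p q = mk≋ λ w → begin
      φ w (p ⊗ q)                        ≈⟨ φ-⊗ w p q ⟩
      φ (λ α → φ (λ β → w (α ⊞ β)) q) p  ≈⟨ φ-swap (λ α β → w (α ⊞ β)) p q ⟩
      φ (λ β → φ (λ α → w (α ⊞ β)) p) q  ≈⟨ φ-cong q (λ β → φ-cong p λ α → reflexive (≡.cong w (⊞-comm α β))) ⟩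
      φ (λ β → φ (λ α → w (β ⊞ α)) p) q  ≈⟨ φ-⊗ w q p ⟨
      φ w (q ⊗ p)                        ∎

    ⊗-identityˡ : ∀ (p : Poly n) → const 1# ⊗ p ≋ p
    ⊗-identityˡ p = mk≋ λ w → begin
      φ w (const 1# ⊗ p)                ≈⟨ φ-⊗ w (const 1#) p ⟩
      φ (λ α → φ (λ β → w (α ⊞ β)) p) (const 1#)  ≈⟨ φ-const (λ α → φ (λ β → w (α ⊞ β)) p) 1# ⟩
      1# * φ (λ β → w (𝟎 ⊞ β)) p        ≈⟨ *-identityˡ _ ⟩
      φ (λ β → w (𝟎 ⊞ β)) p             ≈⟨ φ-cong p (λ β → reflexive (≡.cong w (⊞-identityˡ β))) ⟩
      φ w p                             ∎

-- Constants, monomials, evaluation and degrees of polynomials.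

module PolynomialProperties (R : RealField) where

  open RealField R hiding (zero)
  open SONC R
  open PolynomialSemiring R
  open import Data.List.Base as List using (List; []; _∷_; filter)
  import Data.List.Properties as List
  open import Data.List.Relation.Unary.All as All using (All; []; _∷_)
  import Data.List.Relation.Unary.All.Properties as All
  open import Algebra.Properties.Ring ring
  open import Relation.Binary.Reasoning.Setoid setoid
  open import Relation.Nullary.Decidable using (Dec; does; yes; no; decidable-stable)

  private module RealCube = CubeSums commutativeSemiring
  open RealCube using (_^^_)

  open import Algebra.Definitions.RawSemiring (CommutativeSemiring.rawSemiring commutativeSemiring)
    using (product)

  module _ {n : ℕ} where
    open CommutativeSemiring (polynomialSemiring n) public
      using ()
      renaming ( refl to ≋-refl; sym to ≋-sym; trans to ≋-trans; reflexive to ≋-reflexive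
               ; setoid to ≋-setoid
               ; +-cong to ⊕-cong; +-congˡ to ⊕-congˡ; +-congʳ to ⊕-congʳ
               ; *-cong to ⊗-cong; *-congˡ to ⊗-congˡ; *-congʳ to ⊗-congʳ
               ; +-identityˡ to ⊕-identityˡ; +-identityʳ to ⊕-identityʳ
               ; +-assoc to ⊕-assoc
               ; *-identityˡ to ⊗-identityˡ; *-identityʳ to ⊗-identityʳ
               ; *-assoc to ⊗-assoc; *-comm to ⊗-comm
               ; zeroˡ to ⊗-zeroˡ; zeroʳ to ⊗-zeroʳ
               ; distribˡ to ⊗-distribˡ-⊕; distribʳ to ⊗-distribʳ-⊕)
    open import Algebra.Definitions.RawSemiring (CommutativeSemiring.rawSemiring (polynomialSemiring n)) public
      using () renaming (product to ⨂; _^_ to infixr 8 _^ᴾ_)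

  mono : ∀ {n} → Exponent n → Poly n
  mono = monomial 1#

  +ᴾ≋⊕ : ∀ {n} (p q : Poly n) → p +ᴾ q ≋ p ⊕ q
  +ᴾ≋⊕ p q = ≋-reflexive (≡.sym (⊕≡+ᴾ p q))

  *ᴾ≋⊗ : ∀ {n} (p q : Poly n) → p *ᴾ q ≋ p ⊗ q
  *ᴾ≋⊗ p q = ≋-reflexive (≡.sym (⊗≡*ᴾ p q))

  φ-const⊗ : ∀ {n} (w : Exponent n → ℝ) c p → φ w (const c ⊗ p) ≈ c * φ w p
  φ-const⊗ w c p = trans (φ-⊗ w (const c) p)
    (trans (φ-const (λ α → φ (λ β → w (α ⊞ β)) p) c)
           (*-congˡ (φ-cong p λ β → reflexive (≡.cong w (⊞-identityˡ β)))))

  -ᴾ≋ : ∀ {n} (p : Poly n) → -ᴾ p ≋ const (- 1#) ⊗ p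
  -ᴾ≋ p = mk≋ λ w → trans (φ-neg w p) (sym (trans (φ-const⊗ w (- 1#) p) (-1*x≈-x _)))

  const-cong : ∀ {n c d} → c ≈ d → const {n} c ≋ const d
  const-cong c≈d = mk≋ λ w → +-congʳ (*-congʳ c≈d)

  const-+ : ∀ {n} c d → const {n} (c + d) ≋ const c ⊕ const d
  const-+ {n} c d = mk≋ λ w → begin
    φ w (const (c + d))                ≈⟨ φ-const w (c + d) ⟩
    (c + d) * w 𝟎                      ≈⟨ distribʳ _ _ _ ⟩
    c * w 𝟎 + d * w 𝟎                  ≈⟨ +-cong (φ-const w c) (φ-const w d) ⟨
    φ w (const c) + φ w (const d)      ≈⟨ φ-⊕ w (const c) (const d) ⟨
    φ w (const c ⊕ const d)            ∎

  const-* : ∀ {n} c d → const {n} (c * d) ≋ const c ⊗ const d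
  const-* c d = mk≋ λ w → begin
    φ w (const (c * d))      ≈⟨ φ-const w (c * d) ⟩
    c * d * w 𝟎              ≈⟨ *-assoc _ _ _ ⟩
    c * (d * w 𝟎)            ≈⟨ *-congˡ (φ-const w d) ⟨
    c * φ w (const d)        ≈⟨ φ-const⊗ w c (const d) ⟨
    φ w (const c ⊗ const d)  ∎

  const-0 : ∀ {n} → const {n} 0# ≋ []
  const-0 = mk≋ λ w → trans (φ-const w 0#) (zeroˡ _)

  const-product : ∀ {n k} (c : Vector ℝ k) → const {n} (product c) ≋ ⨂ (const ∘ c)
  const-product {k = zero}  c = ≋-refl
  const-product {k = suc k} c = ≋-trans (const-* _ _) (⊗-congˡ (const-product (c ∘ suc)))

  const-1+const-−1 : ∀ {n} → const {n} 1# ⊕ const (- 1#) ≋ []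
  const-1+const-−1 = ≋-trans (≋-sym (const-+ _ _)) (≋-trans (const-cong (-‿inverseʳ 1#)) const-0)

  ∷≋ : ∀ {n} c (α : Exponent n) p → (c , α) ∷ p ≋ const c ⊗ mono α ⊕ p
  ∷≋ c α p = mk≋ λ w → sym (begin
    φ w (const c ⊗ mono α ⊕ p)            ≈⟨ φ-⊕ w (const c ⊗ mono α) p ⟩
    φ w (const c ⊗ mono α) + φ w p        ≈⟨ +-congʳ (φ-const⊗ w c (mono α)) ⟩
    c * φ w (mono α) + φ w p              ≈⟨ +-congʳ (*-congˡ (trans (+-identityʳ _) (*-identityˡ _))) ⟩
    c * w α + φ w p                       ∎)

  mono-⊞ : ∀ {n} (α β : Exponent n) → mono (α ⊞ β) ≋ mono α ⊗ mono β
  mono-⊞ α β = mk≋ λ w → sym (begin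
    φ w (mono α ⊗ mono β)                        ≈⟨ φ-⊗ w (mono α) (mono β) ⟩
    1# * (1# * w (α ⊞ β) + 0#) + 0#              ≈⟨ +-congʳ (*-identityˡ _) ⟩
    1# * w (α ⊞ β) + 0# + 0#                     ≈⟨ +-identityʳ _ ⟩
    1# * w (α ⊞ β) + 0#                          ∎)

  mono≋^^ : ∀ {n} (α : Exponent n) → mono α ≋ CubeSums._^^_ (polynomialSemiring n) var α
  mono≋^^ {n} = exponent-induction _ (≋-sym (^^-𝟎 var))
    λ i α IH → ≋-trans (mono-⊞ (unit i) α)
      (≋-trans (⊗-cong (≋-sym (^^-unit var i)) IH) (≋-sym (^^-⊞ var (unit i) α)))
    where open CubeSums (polynomialSemiring n) using (^^-𝟎; ^^-⊞; ^^-unit)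

  eval≈φ : ∀ {n} p (x : Point n) → eval p x ≈ φ (x ^^_) p
  eval≈φ []            x = refl
  eval≈φ ((c , α) ∷ p) x = +-congˡ (eval≈φ p x)

  eval-cong : ∀ {n} {p q : Poly n} x → p ≋ q → eval p x ≈ eval q x
  eval-cong {p = p} {q} x p≋q = trans (eval≈φ p x) (trans (φ≈ p≋q _) (sym (eval≈φ q x)))

  eval-⊕ : ∀ {n} p q (x : Point n) → eval (p ⊕ q) x ≈ eval p x + eval q x
  eval-⊕ p q x = trans (eval≈φ (p ⊕ q) x)
    (trans (φ-⊕ _ p q) (sym (+-cong (eval≈φ p x) (eval≈φ q x))))

  eval-⊗ : ∀ {n} p q (x : Point n) → eval (p ⊗ q) x ≈ eval p x * eval q x
  eval-⊗ p q x = begin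
    eval (p ⊗ q) x                                     ≈⟨ eval≈φ (p ⊗ q) x ⟩
    φ (x ^^_) (p ⊗ q)                                  ≈⟨ φ-⊗ _ p q ⟩
    φ (λ α → φ (λ β → x ^^ (α ⊞ β)) q) p               ≈⟨ φ-cong p (λ α → φ-cong q (RealCube.^^-⊞ x α)) ⟩
    φ (λ α → φ (λ β → x ^^ α * x ^^ β) q) p            ≈⟨ φ-cong p (λ α → trans (φ-scale _ _ q) (*-comm _ _)) ⟩
    φ (λ α → φ (x ^^_) q * x ^^ α) p                   ≈⟨ φ-scale _ _ p ⟩
    φ (x ^^_) q * φ (x ^^_) p                          ≈⟨ *-comm _ _ ⟩
    φ (x ^^_) p * φ (x ^^_) q                          ≈⟨ *-cong (eval≈φ p x) (eval≈φ q x) ⟨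
    eval p x * eval q x                                ∎

  eval-mono : ∀ {n} α (x : Point n) → eval (mono α) x ≈ x ^^ α
  eval-mono α x = trans (+-identityʳ _) (*-identityˡ _)

  eval-var : ∀ {n} j (x : Point n) → eval (var j) x ≈ x j
  eval-var j x = trans (eval-mono (unit j) x) (RealCube.^^-unit x j)

  eval-const : ∀ {n} c (x : Point n) → eval (const c) x ≈ c
  eval-const c x = trans (+-identityʳ _) (trans (*-congˡ (RealCube.^^-𝟎 x)) (*-identityʳ c))

  eval-−ᴾ : ∀ {n} p q (x : Point n) → eval (p -ᴾ q) x ≈ eval p x - eval q x
  eval-−ᴾ p q x = begin
    eval (p -ᴾ q) x                              ≈⟨ eval≈φ (p -ᴾ q) x ⟩
    φ (x ^^_) (p -ᴾ q)                           ≈⟨ φ-++ _ p (-ᴾ q) ⟩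
    φ (x ^^_) p + φ (x ^^_) (-ᴾ q)               ≈⟨ +-congˡ (φ-neg _ q) ⟩
    φ (x ^^_) p - φ (x ^^_) q                    ≈⟨ +-cong (eval≈φ p x) (-‿cong (eval≈φ q x)) ⟨
    eval p x - eval q x                          ∎

  eval-⨂ : ∀ {n k} (F : Vector (Poly n) k) x → eval (⨂ F) x ≈ product (λ i → eval (F i) x)
  eval-⨂ {k = zero}  F x = eval-const 1# x
  eval-⨂ {k = suc k} F x = trans (eval-⊗ _ _ x) (*-congˡ (eval-⨂ (F ∘ suc) x))

  Bounded : ∀ {n} → ℕ → Poly n → Set
  Bounded e = All λ (_ , α) → ∣ α ∣ ℕ.≤ e

  -- A representative without terms of high degree turns degree bounds into
  -- syntactic ones.
  HasDegree : ∀ {n} → ℕ → Poly n → Set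
  HasDegree e p = ∃[ p′ ] (p ≋ p′ × Bounded e p′)

  degree≤? : ∀ {n} e ((_ , α) : ℝ × Exponent n) → Dec (∣ α ∣ ℕ.≤ e)
  degree≤? e (_ , α) = ∣ α ∣ ℕ.≤? e

  truncate : ∀ {n} → ℕ → Poly n → Poly n
  truncate e = filter (degree≤? e)

  coeff-truncate : ∀ {n} e p (α : Exponent n) → ∣ α ∣ ℕ.≤ e → coeff (truncate e p) α ≈ coeff p α
  coeff-truncate e []            α α≤e = refl
  coeff-truncate e ((c , β) ∷ p) α α≤e = case degree≤? e (c , β) of λ
    { (yes β≤e) → trans (head (List.filter-accept (degree≤? e) {c , β} {p} β≤e)) (+-congˡ (coeff-truncate e p α α≤e))
    ; (no  β≰e) → trans (head (List.filter-reject (degree≤? e) {c , β} {p} β≰e))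
      (trans (coeff-truncate e p α α≤e) (sym (trans (+-congʳ (c≈0 β≰e)) (+-identityˡ _)))) }
    where
    head : ∀ {q q′ : Poly _} → q ≡ q′ → coeff q α ≈ coeff q′ α
    head = reflexive ∘ ≡.cong (λ q → coeff q α)

    c≈0 : ¬ ∣ β ∣ ℕ.≤ e → (if does (β ≟ᴱ α) then c else 0#) ≈ 0#
    c≈0 β≰e with β ≟ᴱ α
    ... | yes ≡.refl = contradiction α≤e β≰e
    ... | no  _      = refl

  coeff-Bounded : ∀ {n e p} (α : Exponent n) → Bounded e p → ¬ ∣ α ∣ ℕ.≤ e → coeff p α ≈ 0#
  coeff-Bounded                       α []          α≰e = refl
  coeff-Bounded {p = (c , β) ∷ p} α (β≤e ∷ p≤e) α≰e with β ≟ᴱ α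
  ... | yes ≡.refl = contradiction β≤e α≰e
  ... | no  _      = trans (+-identityˡ _) (coeff-Bounded α p≤e α≰e)

  -- Terms of degree above `e` can occur in the list if their coefficients cancel; deleting them all
  -- changes no collected coefficient.
  Degree≤⇒HasDegree : ∀ {n e} {p : Poly n} → Degree≤ e p → HasDegree e p
  Degree≤⇒HasDegree {e = e} {p} deg = truncate e p , ≈ᴾ⇒≋ same , All.all-filter (degree≤? e) p
    where
    open import Relation.Binary.Structures using (IsDecTotalOrder)
    same : p ≈ᴾ truncate e p
    same α with ∣ α ∣ ℕ.≤? e
    ... | yes α≤e = sym (coeff-truncate e p α α≤e)
    -- `deg` only refutes that the coefficient is nonzero; decidable equality of reals turns this
    -- into vanishing.
    ... | no  α≰e = trans
      (decidable-stable (IsDecTotalOrder._≟_ isDecTotalOrder _ _) (α≰e ∘ deg α))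
      (sym (coeff-Bounded α (All.all-filter (degree≤? e) p) α≰e))

  HasDegree⇒Degree≤ : ∀ {n e} {p : Poly n} → HasDegree e p → Degree≤ e p
  HasDegree⇒Degree≤ {e = e} (p′ , p≋p′ , bd) α coeff≉0 =
    decidable-stable (∣ α ∣ ℕ.≤? e)
      λ α≰e → coeff≉0 (trans (≋⇒≈ᴾ p≋p′ α) (coeff-Bounded α bd α≰e))

  HasDegree-resp : ∀ {n e} {p q : Poly n} → p ≋ q → HasDegree e q → HasDegree e p
  HasDegree-resp p≋q (q′ , q≋q′ , bd) = q′ , ≋-trans p≋q q≋q′ , bd

  HasDegree-≤ : ∀ {n d e} {p : Poly n} → d ℕ.≤ e → HasDegree d p → HasDegree e p
  HasDegree-≤ d≤e (p′ , p≋p′ , bd) = p′ , p≋p′ , All.map (λ α≤d → ℕ.≤-trans α≤d d≤e) bd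

  HasDegree-⊕ : ∀ {n e} {p q : Poly n} → HasDegree e p → HasDegree e q → HasDegree e (p ⊕ q)
  HasDegree-⊕ (p′ , p≋ , bp) (q′ , q≋ , bq) =
    p′ +ᴾ q′ , ≋-trans (⊕-cong p≋ q≋) (≋-sym (+ᴾ≋⊕ p′ q′)) , All.++⁺ bp bq

  HasDegree-⊗ : ∀ {n d e} {p q : Poly n} → HasDegree d p → HasDegree e q → HasDegree (d ℕ.+ e) (p ⊗ q)
  HasDegree-⊗ {d = d} {e} (p′ , p≋ , bp) (q′ , q≋ , bq) =
    p′ *ᴾ q′ , ≋-trans (⊗-cong p≋ q≋) (≋-sym (*ᴾ≋⊗ p′ q′)) , bounded bp
    where
    row : ∀ c α {q} → ∣ α ∣ ℕ.≤ d → Bounded e q → Bounded (d ℕ.+ e) (List.map (λ (c′ , β) → c * c′ , α ⊞ β) q)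
    row c α α≤d []         = []
    row c α α≤d (β≤e ∷ bq) =
      ≡.subst (ℕ._≤ d ℕ.+ e) (≡.sym (∣⊞∣ α _)) (ℕ.+-mono-≤ α≤d β≤e) ∷ row c α α≤d bq

    bounded : ∀ {p} → Bounded d p → Bounded (d ℕ.+ e) (p *ᴾ q′)
    bounded []         = []
    bounded {(c , α) ∷ p} (α≤d ∷ bp) = All.++⁺ (row c α α≤d bq) (bounded bp)

  HasDegree-mono : ∀ {n} c (α : Exponent n) → HasDegree ∣ α ∣ (monomial c α)
  HasDegree-mono c α = monomial c α , ≋-refl , ℕ.≤-refl ∷ []

  HasDegree-const : ∀ {n} c → HasDegree 0 (const {n} c)
  HasDegree-const {n} c = ≡.subst (λ e → HasDegree e (const {n} c)) (∣𝟎∣ n) (HasDegree-mono c 𝟎)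

  HasDegree-var : ∀ {n} j → HasDegree 1 (var {n} j)
  HasDegree-var j = ≡.subst (λ e → HasDegree e (var j)) (∣unit∣ j) (HasDegree-mono 1# (unit j))

  HasDegree-−ᴾ : ∀ {n e} {p : Poly n} → HasDegree e p → HasDegree e (-ᴾ p)
  HasDegree-−ᴾ {p = p} deg = HasDegree-resp (-ᴾ≋ p) (HasDegree-⊗ {p = const (- 1#)} (HasDegree-const (- 1#)) deg)

-- Signs in an ordered field.

module RealOrder (R : RealField) where

  open RealField R hiding (zero)
  open import Data.Sum.Base using (inj₁; inj₂)
  open import Relation.Binary.Structures using (IsDecTotalOrder)
  open import Algebra.Properties.Ring ring
  open import Algebra.Definitions.RawSemiring (CommutativeSemiring.rawSemiring commutativeSemiring)
    using (product)
  open IsDecTotalOrder isDecTotalOrder public using (total; _≤?_; ≤-respˡ-≈; ≤-respʳ-≈)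
    renaming (reflexive to ≤-reflexive)

  ≤⇒0≤- : ∀ {x y} → x ≤ y → 0# ≤ y - x
  ≤⇒0≤- {x} x≤y = ≤-respˡ-≈ (-‿inverseˡ x) (≤-respʳ-≈ (+-comm _ _) (+-monoʳ-≤ (- x) x≤y))

  ≤0⇒0≤- : ∀ {x} → x ≤ 0# → 0# ≤ - x
  ≤0⇒0≤- x≤0 = ≤-respʳ-≈ (+-identityˡ _) (≤⇒0≤- x≤0)

  ≰⇒0≤- : ∀ {x} → ¬ 0# ≤ x → 0# ≤ - x
  ≰⇒0≤- {x} x≱0 with total 0# x
  ... | inj₁ 0≤x = contradiction 0≤x x≱0
  ... | inj₂ x≤0 = ≤0⇒0≤- x≤0

  -x*-y≈x*y : ∀ x y → - x * - y ≈ x * y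
  -x*-y≈x*y x y = trans (sym (-‿distribˡ-* x (- y)))
    (trans (-‿cong (sym (-‿distribʳ-* x y))) (-‿involutive _))

  *-nonPos : ∀ {x y} → 0# ≤ - x → 0# ≤ - y → 0# ≤ x * y
  *-nonPos {x} {y} 0≤-x 0≤-y = ≤-respʳ-≈ (-x*-y≈x*y x y) (*-nonNeg 0≤-x 0≤-y)

  square-nonNeg : ∀ x → 0# ≤ x * x
  square-nonNeg x with total 0# x
  ... | inj₁ 0≤x = *-nonNeg 0≤x 0≤x
  ... | inj₂ x≤0 = *-nonPos (≤0⇒0≤- x≤0) (≤0⇒0≤- x≤0)

  0≤1 : 0# ≤ 1#
  0≤1 = ≤-respʳ-≈ (*-identityˡ 1#) (square-nonNeg 1#)

  0<1 : 0# < 1#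
  0<1 = 0≤1 , 1≉0 ∘ sym

  -- The inverse is y = x y², a product of nonnegative numbers.
  inverse-nonNeg : ∀ {x y} → y * x ≈ 1# → 0# ≤ x → 0# ≤ y
  inverse-nonNeg {x} {y} yx≈1 0≤x =
    ≤-respʳ-≈ (trans (sym (*-assoc _ _ _)) (trans (*-congʳ (trans (*-comm x y) yx≈1)) (*-identityˡ y)))
      (*-nonNeg 0≤x (square-nonNeg y))

  product-nonNeg : ∀ {k} {w : Vector ℝ k} → (∀ i → 0# ≤ w i) → 0# ≤ product w
  product-nonNeg {zero}  0≤w = 0≤1
  product-nonNeg {suc k} 0≤w = *-nonNeg (0≤w zero) (product-nonNeg (0≤w ∘ suc))

module Certificates
  (R : RealField) {n m : ℕ} (d : ℕ)
  (a b : Vector (RealField.ℝ R) n) (a<b : ∀ j → RealField._<_ R (a j) (b j))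
  (p : Vector (SONC.Poly R n) m) (deg-p : ∀ i → SONC.Degree≤ R d (p i))
  where

  open RealField R hiding (zero)
  open SONC R
  open Hypercube a b p
  open PolynomialSemiring R using (_≋_; _⊕_; _⊗_; ≋⇒≈ᴾ; polynomialSemiring)
  open PolynomialProperties R
  open RealOrder R
  open import Algebra.Definitions.RawSemiring (CommutativeSemiring.rawSemiring commutativeSemiring)
    using (product; _^_)
  open import Algebra.Properties.Ring ring using (x∙y⁻¹≈ε⇒x≈y)
  import Algebra.Solver.Ring.NaturalCoefficients.Default (polynomialSemiring n) as P
  open import Data.Fin.Properties using (any?; ¬∀⟶∃¬)
  open import Data.List.Base as List using (List; []; _∷_; length)
  import Data.List.Properties as List
  open import Data.List.Relation.Unary.All using ([]; _∷_)
  open import Data.Nat.Divisibility using (_∣_; _∣0)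
  open import Data.Sum.Base using (inj₁; inj₂)
  open import Relation.Binary.Reasoning.Setoid (≋-setoid {n})
  open import Relation.Nullary.Decidable using (yes; no)

  private
    module RealCube = CubeSums commutativeSemiring
    module PolyCube = CubeSums (polynomialSemiring n)
  open PolyCube using (cubeSum; cubeSum-cong; cubeSum-+; cubeSum-*ˡ; cubeSum-0; cubeSum-single)

  -- Constraints and their degrees.

  D : ℕ
  D = n ℕ.+ d

  -- A degree bound read off from the constraint alone, so that bounding a product means adding
  -- numbers. Each `given i` is charged the common bound `d`.
  weight : Constraint → ℕ
  weight one         = 0
  weight (+g j)      = 2
  weight (-g j)      = 2
  weight (x-lower j) = 1
  weight (upper-x j) = 1
  weight (given i)   = d

  weights : List Constraint → ℕ
  weights []      = 0
  weights (c ∷ l) = weight c ℕ.+ weights l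

  A B : Fin n → Poly n
  A = const ∘ a
  B = const ∘ b

  -- The solver works in a commutative semiring, where -1 is an atom like any other. Cancellations
  -- are therefore prepared by inserting zeros of the form `q ⊕ N ⊗ q`.
  N : Poly n
  N = const (- 1#)

  q+Nq≋0 : ∀ (q : Poly n) → q ⊕ N ⊗ q ≋ []
  q+Nq≋0 q = begin
    q ⊕ N ⊗ q              ≈⟨ ⊕-congʳ (⊗-identityˡ q) ⟨
    const 1# ⊗ q ⊕ N ⊗ q   ≈⟨ ⊗-distribʳ-⊕ q (const 1#) N ⟨
    (const 1# ⊕ N) ⊗ q     ≈⟨ ⊗-congʳ const-1+const-−1 ⟩
    [] ⊗ q                 ≈⟨ ⊗-zeroˡ q ⟩
    []                     ∎

  −ᴾ≋ : ∀ (q r : Poly n) → q -ᴾ r ≋ q ⊕ N ⊗ r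
  −ᴾ≋ q r = ≋-trans (+ᴾ≋⊕ q (-ᴾ r)) (⊕-congˡ (-ᴾ≋ r))

  g≋ : ∀ j → g j ≋ (var j ⊕ N ⊗ A j) ⊗ (var j ⊕ N ⊗ B j)
  g≋ j = ≋-trans (*ᴾ≋⊗ (var j -ᴾ A j) (var j -ᴾ B j)) (⊗-cong (−ᴾ≋ (var j) (A j)) (−ᴾ≋ (var j) (B j)))

  HasDegree-linear : ∀ {q r : Poly n} → HasDegree 1 q → HasDegree 1 r → HasDegree 1 (q -ᴾ r)
  HasDegree-linear {q} {r} deg-q deg-r =
    HasDegree-resp (+ᴾ≋⊕ q (-ᴾ r)) (HasDegree-⊕ deg-q (HasDegree-−ᴾ deg-r))

  HasDegree-g : ∀ j → HasDegree 2 (g j)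
  HasDegree-g j = HasDegree-resp (*ᴾ≋⊗ (var j -ᴾ A j) (var j -ᴾ B j))
    (HasDegree-⊗ (HasDegree-linear (HasDegree-var j) (HasDegree-≤ ℕ.z≤n (HasDegree-const (a j))))
                 (HasDegree-linear (HasDegree-var j) (HasDegree-≤ ℕ.z≤n (HasDegree-const (b j)))))

  HasDegree-constraint : ∀ c → HasDegree (weight c) (constraint c)
  HasDegree-constraint one         = HasDegree-const 1#
  HasDegree-constraint (+g j)      = HasDegree-g j
  HasDegree-constraint (-g j)      = HasDegree-−ᴾ (HasDegree-g j)
  HasDegree-constraint (x-lower j) = HasDegree-linear (HasDegree-var j) (HasDegree-≤ ℕ.z≤n (HasDegree-const (a j)))
  HasDegree-constraint (upper-x j) = HasDegree-linear (HasDegree-≤ ℕ.z≤n (HasDegree-const (b j))) (HasDegree-var j)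
  HasDegree-constraint (given i)   = Degree≤⇒HasDegree (deg-p i)

  -- The cone of polynomials with a certificate.

  Πᶜ : List Constraint → Poly n
  Πᶜ []      = const 1#
  Πᶜ (c ∷ l) = constraint c ⊗ Πᶜ l

  HasDegree-Πᶜ : ∀ l → HasDegree (weights l) (Πᶜ l)
  HasDegree-Πᶜ []      = HasDegree-const 1#
  HasDegree-Πᶜ (c ∷ l) = HasDegree-⊗ (HasDegree-constraint c) (HasDegree-Πᶜ l)

  -- A summand of a certificate with a constant multiplier. The bound on the length does not follow
  -- from that on the weights, since `given i` has weight 0 when `d` is 0.
  record Term : Set where
    field
      coefficient : ℝ
      nonNeg      : 0# ≤ coefficient
      factors     : List Constraint
      length≤     : length factors ℕ.≤ suc D
      weights≤    : weights factors ℕ.≤ D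

    value : Poly n
    value = const coefficient ⊗ Πᶜ factors

  values : List Term → Poly n
  values []       = []
  values (t ∷ ts) = Term.value t ⊕ values ts

  Cone : Poly n → Set
  Cone f = ∃[ ts ] f ≋ values ts

  Cone-resp : ∀ {f h} → f ≋ h → Cone h → Cone f
  Cone-resp f≋h (ts , h≋) = ts , ≋-trans f≋h h≋

  Cone-0 : Cone []
  Cone-0 = [] , ≋-refl

  values-++ : ∀ ts us → values (ts List.++ us) ≋ values ts ⊕ values us
  values-++ []       us = ≋-sym (⊕-identityˡ (values us))
  values-++ (t ∷ ts) us = ≋-trans (⊕-congˡ (values-++ ts us)) (≋-sym (⊕-assoc (Term.value t) (values ts) (values us)))

  Cone-⊕ : ∀ {f h} → Cone f → Cone h → Cone (f ⊕ h)
  Cone-⊕ (ts , f≋) (us , h≋) = ts List.++ us , ≋-trans (⊕-cong f≋ h≋) (≋-sym (values-++ ts us))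

  Cone-cubeSum : ∀ k {F} → (∀ v → Cone (F v)) → Cone (cubeSum k F)
  Cone-cubeSum zero    F∈ = F∈ []
  Cone-cubeSum (suc k) F∈ = Cone-⊕ (Cone-cubeSum k (F∈ ∘ (false ∷_))) (Cone-cubeSum k (F∈ ∘ (true ∷_)))

  Cone-term : ∀ {c} l → 0# ≤ c → length l ℕ.≤ suc D → weights l ℕ.≤ D → Cone (const c ⊗ Πᶜ l)
  Cone-term l 0≤c len wt =
    record { nonNeg = 0≤c ; factors = l ; length≤ = len ; weights≤ = wt } ∷ [] ,
    ≋-sym (⊕-identityʳ _)

  -- The largest linear subspace contained in the cone.
  Negligible : Poly n → Set
  Negligible f = ∀ c → Cone (const c ⊗ f)

  Negligible-resp : ∀ {f h} → f ≋ h → Negligible h → Negligible f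
  Negligible-resp f≋h h∈ c = Cone-resp (⊗-congˡ f≋h) (h∈ c)

  Negligible-0 : Negligible []
  Negligible-0 c = Cone-resp (⊗-zeroʳ (const c)) Cone-0

  Negligible-⊕ : ∀ {f h} → Negligible f → Negligible h → Negligible (f ⊕ h)
  Negligible-⊕ {f} {h} f∈ h∈ c = Cone-resp (⊗-distribˡ-⊕ (const c) f h) (Cone-⊕ (f∈ c) (h∈ c))

  Negligible-scale : ∀ c {f} → Negligible f → Negligible (const c ⊗ f)
  Negligible-scale c {f} f∈ e = Cone-resp
    (≋-trans (≋-sym (⊗-assoc (const e) (const c) f)) (⊗-congʳ (≋-sym (const-* e c)))) (f∈ (e * c))

  Negligible⇒Cone : ∀ {f} → Negligible f → Cone f
  Negligible⇒Cone {f} f∈ = Cone-resp (≋-sym (⊗-identityˡ f)) (f∈ 1#)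

  -- Both signs of `g j` are constraints: a negative multiple c of `g j` is the nonnegative multiple
  -- -c of its negative.
  Negligible-g⊗Πᶜ : ∀ j l → suc (length l) ℕ.≤ suc D → 2 ℕ.+ weights l ℕ.≤ D → Negligible (g j ⊗ Πᶜ l)
  Negligible-g⊗Πᶜ j l len wt c with total 0# c
  ... | inj₁ 0≤c = Cone-term (+g j ∷ l) 0≤c len wt
  ... | inj₂ c≤0 = Cone-resp eq (Cone-term (-g j ∷ l) (≤0⇒0≤- c≤0) len wt)
    where
    eq : const c ⊗ (g j ⊗ Πᶜ l) ≋ const (- c) ⊗ (-ᴾ g j ⊗ Πᶜ l)
    eq = begin
      const c ⊗ (g j ⊗ Πᶜ l)                ≈⟨ ⊗-congʳ (const-cong (trans (sym (*-identityʳ c)) (sym (-x*-y≈x*y c 1#)))) ⟩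
      const (- c * - 1#) ⊗ (g j ⊗ Πᶜ l)     ≈⟨ ⊗-congʳ (const-* (- c) (- 1#)) ⟩
      const (- c) ⊗ N ⊗ (g j ⊗ Πᶜ l)
        ≈⟨ P.solve 4 (λ u v w x → u P.:* v P.:* (w P.:* x) P.:= u P.:* (v P.:* w P.:* x)) ≋-refl (const (- c)) N (g j) (Πᶜ l) ⟩
      const (- c) ⊗ (N ⊗ g j ⊗ Πᶜ l)        ≈⟨ ⊗-congˡ (⊗-congʳ (-ᴾ≋ (g j))) ⟨
      const (- c) ⊗ (-ᴾ g j ⊗ Πᶜ l)         ∎

  -- Expanding every variable of x^α as (xᵢ - aᵢ) + aᵢ.
  Negligible-g⊗mono : ∀ j α l → suc (length l ℕ.+ ∣ α ∣) ℕ.≤ suc D → 2 ℕ.+ (weights l ℕ.+ ∣ α ∣) ℕ.≤ D →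
                      Negligible (g j ⊗ (Πᶜ l ⊗ mono α))
  Negligible-g⊗mono j = exponent-induction Claim base step
    where
    Claim : Exponent n → Set
    Claim α = ∀ l → suc (length l ℕ.+ ∣ α ∣) ℕ.≤ suc D → 2 ℕ.+ (weights l ℕ.+ ∣ α ∣) ℕ.≤ D →
              Negligible (g j ⊗ (Πᶜ l ⊗ mono α))

    base : Claim 𝟎
    base l len wt = Negligible-resp (⊗-congˡ (⊗-identityʳ (Πᶜ l)))
      (Negligible-g⊗Πᶜ j l (ℕ.≤-trans (ℕ.s≤s (ℕ.m≤m+n _ _)) len)
                           (ℕ.≤-trans (ℕ.+-monoʳ-≤ 2 (ℕ.m≤m+n _ _)) wt))

    step : ∀ i α → Claim α → Claim (unit i ⊞ α)
    -- In the first summand one degree moves from the monomial to the list, which preserves both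
    -- totals (`shift`); in the second it is replaced by the constant aᵢ and lost (`drop`).
    step i α IH l len wt = Negligible-resp eq
      (Negligible-⊕ (IH (x-lower i ∷ l) (≡.subst (λ e → suc e ℕ.≤ suc D) (shift (length l)) len)
                                        (≡.subst (λ e → 2 ℕ.+ e ℕ.≤ D) (shift (weights l)) wt))
                    (Negligible-scale (a i)
                      (IH l (ℕ.≤-trans (ℕ.s≤s (drop (length l))) len)
                            (ℕ.≤-trans (ℕ.+-monoʳ-≤ 2 (drop (weights l))) wt))))
      where
      shift : ∀ k → k ℕ.+ ∣ unit i ⊞ α ∣ ≡ suc k ℕ.+ ∣ α ∣
      shift k = ≡.trans (≡.cong (k ℕ.+_) (∣unit⊞∣ i α)) (ℕ.+-suc k ∣ α ∣)

      drop : ∀ k → k ℕ.+ ∣ α ∣ ℕ.≤ k ℕ.+ ∣ unit i ⊞ α ∣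
      drop k = ≡.subst (k ℕ.+ ∣ α ∣ ℕ.≤_) (≡.sym (shift k)) (ℕ.n≤1+n _)

      eq : g j ⊗ (Πᶜ l ⊗ mono (unit i ⊞ α)) ≋
           g j ⊗ (constraint (x-lower i) ⊗ Πᶜ l ⊗ mono α) ⊕ A i ⊗ (g j ⊗ (Πᶜ l ⊗ mono α))
      eq = begin
        g j ⊗ (Πᶜ l ⊗ mono (unit i ⊞ α))
          ≈⟨ ⊗-congˡ (⊗-congˡ (mono-⊞ (unit i) α)) ⟩
        g j ⊗ (Πᶜ l ⊗ (var i ⊗ mono α))
          ≈⟨ ⊕-identityʳ _ ⟨
        g j ⊗ (Πᶜ l ⊗ (var i ⊗ mono α)) ⊕ []
          ≈⟨ ⊕-congˡ (≋-trans (⊗-congʳ (q+Nq≋0 (A i))) (⊗-zeroˡ _)) ⟨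
        g j ⊗ (Πᶜ l ⊗ (var i ⊗ mono α)) ⊕ (A i ⊕ N ⊗ A i) ⊗ (g j ⊗ (Πᶜ l ⊗ mono α))
          ≈⟨ P.solve 6 (λ g l x m a n → g P.:* (l P.:* (x P.:* m)) P.:+ (a P.:+ n P.:* a) P.:* (g P.:* (l P.:* m))
               P.:= g P.:* ((x P.:+ n P.:* a) P.:* l P.:* m) P.:+ a P.:* (g P.:* (l P.:* m)))
               ≋-refl (g j) (Πᶜ l) (var i) (mono α) (A i) N ⟩
        g j ⊗ ((var i ⊕ N ⊗ A i) ⊗ Πᶜ l ⊗ mono α) ⊕ A i ⊗ (g j ⊗ (Πᶜ l ⊗ mono α))
          ≈⟨ ⊕-congʳ (⊗-congˡ (⊗-congʳ (⊗-congʳ (−ᴾ≋ (var i) (A i))))) ⟨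
        g j ⊗ (constraint (x-lower i) ⊗ Πᶜ l ⊗ mono α) ⊕ A i ⊗ (g j ⊗ (Πᶜ l ⊗ mono α)) ∎

  -- Vertices are encoded as v : Vec Bool n, with false for aᵢ and true for bᵢ.
  coordinate : Fin n → Bool → ℝ
  coordinate i t = if t then b i else a i

  vertex : Vec Bool n → Point n
  vertex v i = coordinate i (lookup v i)

  -- The Lagrange basis of the vertices.

  gap≉0 : ∀ i → ¬ (b i - a i ≈ 0#)
  gap≉0 i b-a≈0 = proj₂ (a<b i) (sym (x∙y⁻¹≈ε⇒x≈y _ _ b-a≈0))

  scale : Fin n → ℝ
  scale i = proj₁ (inverse (gap≉0 i))

  scale*gap≈1 : ∀ i → scale i * (b i - a i) ≈ 1#
  scale*gap≈1 i = proj₁ (proj₂ (inverse (gap≉0 i)))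

  scale≥0 : ∀ i → 0# ≤ scale i
  scale≥0 i = inverse-nonNeg (scale*gap≈1 i) (≤⇒0≤- (proj₁ (a<b i)))

  -- The facet of the box opposite to the one containing the vertex.
  facet : Fin n → Bool → Constraint
  facet i false = upper-x i
  facet i true  = x-lower i

  -- The Lagrange polynomial of degree 1 for the nodes aᵢ and bᵢ. As `scale i` is the inverse of bᵢ
  -- - aᵢ > 0, it is a positive multiple of a box constraint.
  kronecker : Fin n → Bool → Poly n
  kronecker i t = const (scale i) ⊗ constraint (facet i t)

  -- The polynomial δᵥ.
  basis : Vec Bool n → Poly n
  basis v = ⨂ (λ i → kronecker i (lookup v i))

  eval-kronecker : ∀ i t x → eval (kronecker i t) x ≈ scale i * eval (constraint (facet i t)) x
  eval-kronecker i t x = trans (eval-⊗ (const (scale i)) (constraint (facet i t)) x) (*-congʳ (eval-const (scale i) x))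

  eval-upper : ∀ i x → eval (constraint (upper-x i)) x ≈ b i - x i
  eval-upper i x = trans (eval-−ᴾ (B i) (var i) x) (+-cong (eval-const (b i) x) (-‿cong (eval-var i x)))

  eval-lower : ∀ i x → eval (constraint (x-lower i)) x ≈ x i - a i
  eval-lower i x = trans (eval-−ᴾ (var i) (A i) x) (+-cong (eval-var i x) (-‿cong (eval-const (a i) x)))

  *-zero : ∀ {x} c → x ≈ 0# → c * x ≈ 0#
  *-zero c x≈0 = trans (*-congˡ x≈0) (zeroʳ c)

  x-y≈0 : ∀ {x y} → x ≈ y → x - y ≈ 0#
  x-y≈0 x≈y = trans (+-congʳ x≈y) (-‿inverseʳ _)

  eval-kronecker-≡ : ∀ i t x → x i ≈ coordinate i t → eval (kronecker i t) x ≈ 1#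
  eval-kronecker-≡ i false x x≈ = trans (eval-kronecker i false x)
    (trans (*-congˡ (trans (eval-upper i x) (+-congˡ (-‿cong x≈)))) (scale*gap≈1 i))
  eval-kronecker-≡ i true  x x≈ = trans (eval-kronecker i true x)
    (trans (*-congˡ (trans (eval-lower i x) (+-congʳ x≈))) (scale*gap≈1 i))

  eval-kronecker-≢ : ∀ i {s t} x → s ≢ t → x i ≈ coordinate i s → eval (kronecker i t) x ≈ 0#
  eval-kronecker-≢ i {false} {false} x s≢t x≈ = contradiction ≡.refl s≢t
  eval-kronecker-≢ i {true}  {true}  x s≢t x≈ = contradiction ≡.refl s≢t
  eval-kronecker-≢ i {true}  {false} x s≢t x≈ = trans (eval-kronecker i false x)
    (*-zero (scale i) (trans (eval-upper i x) (x-y≈0 (sym x≈))))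
  eval-kronecker-≢ i {false} {true}  x s≢t x≈ = trans (eval-kronecker i true x)
    (*-zero (scale i) (trans (eval-lower i x) (x-y≈0 x≈)))

  eval-basis-≡ : ∀ v → eval (basis v) (vertex v) ≈ 1#
  eval-basis-≡ v = trans (eval-⨂ (λ i → kronecker i (lookup v i)) (vertex v))
    (RealCube.product-1 λ i → eval-kronecker-≡ i (lookup v i) (vertex v) refl)

  differ : ∀ {k} (u v : Vec Bool k) → u ≢ v → ∃[ i ] lookup u i ≢ lookup v i
  differ u v u≢v = ¬∀⟶∃¬ _ _ (λ i → lookup u i Bool.≟ lookup v i) (u≢v ∘ lookup-injective u v)
    where
    lookup-injective : ∀ {k} (u v : Vec Bool k) → (∀ i → lookup u i ≡ lookup v i) → u ≡ v
    lookup-injective []      []      eq = ≡.refl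
    lookup-injective (s ∷ u) (t ∷ v) eq = ≡.cong₂ _∷_ (eq zero) (lookup-injective u v (eq ∘ suc))

  eval-basis-≢ : ∀ u v → u ≢ v → eval (basis v) (vertex u) ≈ 0#
  eval-basis-≢ u v u≢v with i , uᵢ≢vᵢ ← differ u v u≢v =
    trans (eval-⨂ (λ i → kronecker i (lookup v i)) (vertex u))
      (RealCube.product-0 i (eval-kronecker-≢ i (vertex u) uᵢ≢vᵢ refl))

  -- It serves twice: multiples of `g j` have interpolant 0, and a vertex is feasible as soon as all
  -- `p i` are nonnegative there.
  eval-g : ∀ j v → eval (g j) (vertex v) ≈ 0#
  eval-g j v = trans
    (trans (eval-cong x (*ᴾ≋⊗ (var j -ᴾ A j) (var j -ᴾ B j))) (eval-⊗ (var j -ᴾ A j) (var j -ᴾ B j) x))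
    (root (lookup v j) refl)
    where
    x = vertex v
    root : ∀ t → x j ≈ coordinate j t → eval (var j -ᴾ A j) x * eval (var j -ᴾ B j) x ≈ 0#
    root false x≈ = trans (*-congʳ (trans (eval-lower j x) (x-y≈0 x≈))) (zeroˡ _)
    root true  x≈ = *-zero _ (trans (eval-−ᴾ (var j) (B j) x)
      (trans (+-cong (eval-var j x) (-‿cong (eval-const (b j) x))) (x-y≈0 x≈)))

  -- Interpolation modulo negligible polynomials.

  interpolant : Poly n → Poly n
  interpolant f = cubeSum n λ v → const (eval f (vertex v)) ⊗ basis v

  interpolant-cong : ∀ {f h} → (∀ v → eval f (vertex v) ≈ eval h (vertex v)) → interpolant f ≋ interpolant h
  interpolant-cong eq = cubeSum-cong n λ v → ⊗-congʳ (const-cong (eq v))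

  interpolant-0 : ∀ {f} → (∀ v → eval f (vertex v) ≈ 0#) → interpolant f ≋ []
  interpolant-0 f≈0 = cubeSum-0 n λ v → ≋-trans (⊗-congʳ (≋-trans (const-cong (f≈0 v)) const-0)) (⊗-zeroˡ _)

  interpolant-⊕ : ∀ f h → interpolant (f ⊕ h) ≋ interpolant f ⊕ interpolant h
  interpolant-⊕ f h = ≋-trans
    (cubeSum-cong n λ v → ≋-trans
      (⊗-congʳ (≋-trans (const-cong (eval-⊕ f h (vertex v))) (const-+ _ _)))
      (⊗-distribʳ-⊕ (basis v) (const (eval f (vertex v))) (const (eval h (vertex v)))))
    (cubeSum-+ n _ _)

  interpolant-scale : ∀ c f → interpolant (const c ⊗ f) ≋ const c ⊗ interpolant f
  interpolant-scale c f = ≋-trans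
    (cubeSum-cong n λ v → ≋-trans
      (⊗-congʳ (≋-trans (const-cong (trans (eval-⊗ (const c) f (vertex v)) (*-congʳ (eval-const c (vertex v)))))
                        (const-* _ _)))
      (⊗-assoc (const c) (const (eval f (vertex v))) (basis v)))
    (cubeSum-*ˡ n (const c) _)

  -- Congruence of `f` and its interpolant modulo the negligible subspace. The interpolant is linear
  -- in `f`, so this property passes to linear combinations and need only be checked on monomials.
  record Reducible (f : Poly n) : Set where
    constructor reduction
    field
      {remainder} : Poly n
      negligible  : Negligible remainder
      f≋          : f ≋ remainder ⊕ interpolant f

  Reducible-resp : ∀ {f h} → f ≋ h → Reducible h → Reducible f
  Reducible-resp {f} {h} f≋h (reduction r∈ h≋) = reduction r∈
    (≋-trans f≋h (≋-trans h≋ (⊕-congˡ (interpolant-cong {h} {f} λ v → eval-cong (vertex v) (≋-sym f≋h)))))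

  Reducible-⊕ : ∀ {f h} → Reducible f → Reducible h → Reducible (f ⊕ h)
  Reducible-⊕ {f} {h} (reduction {r} r∈ f≋) (reduction {s} s∈ h≋) = reduction (Negligible-⊕ r∈ s∈) (begin
    f ⊕ h                                          ≈⟨ ⊕-cong f≋ h≋ ⟩
    (r ⊕ interpolant f) ⊕ (s ⊕ interpolant h)
        ≈⟨ P.solve 4 (λ r f s h → (r P.:+ f) P.:+ (s P.:+ h) P.:= (r P.:+ s) P.:+ (f P.:+ h)) ≋-refl r (interpolant f) s (interpolant h) ⟩
    (r ⊕ s) ⊕ (interpolant f ⊕ interpolant h)      ≈⟨ ⊕-congˡ (interpolant-⊕ f h) ⟨
    (r ⊕ s) ⊕ interpolant (f ⊕ h)                  ∎)

  Reducible-scale : ∀ c {f} → Reducible f → Reducible (const c ⊗ f)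
  Reducible-scale c {f} (reduction {r} r∈ f≋) = reduction (Negligible-scale c r∈) (begin
    const c ⊗ f                                    ≈⟨ ⊗-congˡ f≋ ⟩
    const c ⊗ (r ⊕ interpolant f)                  ≈⟨ ⊗-distribˡ-⊕ (const c) r (interpolant f) ⟩
    const c ⊗ r ⊕ const c ⊗ interpolant f          ≈⟨ ⊕-congˡ (interpolant-scale c f) ⟨
    const c ⊗ r ⊕ interpolant (const c ⊗ f)        ∎)

  Reducible-0 : Reducible []
  Reducible-0 = reduction Negligible-0 (≋-sym (≋-trans (⊕-identityˡ _) (interpolant-0 {[]} λ v → refl)))

  -- The whole polynomial is the remainder, because it vanishes at every vertex.
  Reducible-g⊗mono : ∀ j α → 2 ℕ.+ ∣ α ∣ ℕ.≤ D → Reducible (g j ⊗ mono α)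
  Reducible-g⊗mono j α α≤D = reduction
    (Negligible-resp (⊗-congˡ (≋-sym (⊗-identityˡ (mono α))))
      (Negligible-g⊗mono j α [] (ℕ.s≤s (ℕ.≤-trans (ℕ.m≤n+m _ 2) α≤D)) α≤D))
    (≋-sym (≋-trans (⊕-congˡ (interpolant-0 {g j ⊗ mono α} λ v → trans (eval-⊗ (g j) (mono α) (vertex v))
      (trans (*-congʳ (eval-g j v)) (zeroˡ _)))) (⊕-identityʳ _)))

  scale⊗gap≋1 : ∀ i → const (scale i) ⊗ (B i ⊕ N ⊗ A i) ≋ const 1#
  scale⊗gap≋1 i = begin
    const (scale i) ⊗ (B i ⊕ N ⊗ A i)   ≈⟨ ⊗-congˡ (⊕-congˡ (-ᴾ≋ (A i))) ⟨
    const (scale i) ⊗ (B i ⊕ -ᴾ A i)    ≈⟨ ⊗-congˡ (const-+ (b i) (- a i)) ⟨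
    const (scale i) ⊗ const (b i - a i) ≈⟨ const-* (scale i) (b i - a i) ⟨
    const (scale i * (b i - a i))       ≈⟨ const-cong (scale*gap≈1 i) ⟩
    const 1#                            ∎

  -- An affine function of one variable is determined by its values at two nodes. For `e = 0` this
  -- says that the two Lagrange polynomials sum to 1.
  linear-interpolation : ∀ i e → e ℕ.≤ 1 →
    var i ^ᴾ e ≋ const (a i ^ e) ⊗ kronecker i false ⊕ const (b i ^ e) ⊗ kronecker i true
  linear-interpolation i zero    e≤1 = ≋-sym (begin
    const 1# ⊗ kronecker i false ⊕ const 1# ⊗ kronecker i true
      ≈⟨ ⊕-cong (⊗-identityˡ (kronecker i false)) (⊗-identityˡ (kronecker i true)) ⟩
    kronecker i false ⊕ kronecker i true
      ≈⟨ ⊕-cong (⊗-congˡ (−ᴾ≋ (B i) (var i))) (⊗-congˡ (−ᴾ≋ (var i) (A i))) ⟩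
    W ⊗ (B i ⊕ N ⊗ var i) ⊕ W ⊗ (var i ⊕ N ⊗ A i)
      ≈⟨ P.solve 5 (λ w x a b n → w P.:* (b P.:+ n P.:* x) P.:+ w P.:* (x P.:+ n P.:* a)
           P.:= w P.:* (b P.:+ n P.:* a) P.:+ w P.:* (x P.:+ n P.:* x)) ≋-refl W (var i) (A i) (B i) N ⟩
    W ⊗ (B i ⊕ N ⊗ A i) ⊕ W ⊗ (var i ⊕ N ⊗ var i)
      ≈⟨ ⊕-cong (scale⊗gap≋1 i) (≋-trans (⊗-congˡ (q+Nq≋0 (var i))) (⊗-zeroʳ W)) ⟩
    const 1# ⊕ []
      ≈⟨ ⊕-identityʳ (const 1#) ⟩
    const 1# ∎)
    where W = const (scale i)
  linear-interpolation i (suc zero) e≤1 = ≋-sym (begin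
    const (a i * 1#) ⊗ kronecker i false ⊕ const (b i * 1#) ⊗ kronecker i true
      ≈⟨ ⊕-cong (⊗-cong (const-cong (*-identityʳ (a i))) (⊗-congˡ (−ᴾ≋ (B i) (var i))))
                (⊗-cong (const-cong (*-identityʳ (b i))) (⊗-congˡ (−ᴾ≋ (var i) (A i)))) ⟩
    A i ⊗ (W ⊗ (B i ⊕ N ⊗ var i)) ⊕ B i ⊗ (W ⊗ (var i ⊕ N ⊗ A i))
      -- The constant terms a w b and -a w b cancel, leaving w (b - a) x.
      ≈⟨ P.solve 5 (λ w x a b n → a P.:* (w P.:* (b P.:+ n P.:* x)) P.:+ b P.:* (w P.:* (x P.:+ n P.:* a))
           P.:= w P.:* (b P.:+ n P.:* a) P.:* x P.:+ (a P.:+ n P.:* a) P.:* (w P.:* b)) ≋-refl W (var i) (A i) (B i) N ⟩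
    W ⊗ (B i ⊕ N ⊗ A i) ⊗ var i ⊕ (A i ⊕ N ⊗ A i) ⊗ (W ⊗ B i)
      ≈⟨ ⊕-cong (⊗-congʳ (scale⊗gap≋1 i)) (≋-trans (⊗-congʳ (q+Nq≋0 (A i))) (⊗-zeroˡ (W ⊗ B i))) ⟩
    const 1# ⊗ var i ⊕ []
      ≈⟨ ≋-trans (⊕-identityʳ _) (⊗-comm (const 1#) (var i)) ⟩
    var i ⊗ const 1# ∎)
    where W = const (scale i)
  linear-interpolation i (suc (suc e)) (ℕ.s≤s ())

  module _ (α : Exponent n) (α≤1 : ∀ i → lookup α i ℕ.≤ 1) where

    sample : Fin n → Bool → ℝ
    sample i t = coordinate i t ^ lookup α i

    -- Every factor of x^α is affine in its variable and is interpolated separately; expanding the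
    -- product gives one multiple of δᵥ per vertex, whose coefficient, the product of the samples,
    -- is the value of x^α there.
    multilinear-interpolation : mono α ≋ interpolant (mono α)
    multilinear-interpolation = begin
      mono α
        ≈⟨ mono≋^^ α ⟩
      ⨂ (λ i → var i ^ᴾ lookup α i)
        ≈⟨ PolyCube.product-cong (λ i → linear-interpolation i (lookup α i) (α≤1 i)) ⟩
      ⨂ (λ i → const (sample i false) ⊗ kronecker i false ⊕ const (sample i true) ⊗ kronecker i true)
        ≈⟨ PolyCube.product-of-sums (λ i t → const (sample i t) ⊗ kronecker i t) ⟩
      cubeSum n (λ v → ⨂ (λ i → const (sample i (lookup v i)) ⊗ kronecker i (lookup v i)))
        ≈⟨ cubeSum-cong n (λ v → ≋-trans
             (PolyCube.product-* (λ i → const (sample i (lookup v i))) (λ i → kronecker i (lookup v i)))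
             (⊗-congʳ (≋-trans (≋-sym (const-product (λ i → sample i (lookup v i)))) (const-cong (sym (eval-mono α (vertex v))))))) ⟩
      interpolant (mono α) ∎

  Reducible-square : ∀ i β → 2 ℕ.+ ∣ β ∣ ℕ.≤ D → Reducible (mono (unit i ⊞ β)) → Reducible (mono β) →
                     Reducible (mono (unit i ⊞ (unit i ⊞ β)))
  Reducible-square i β β≤D xβ-red β-red = Reducible-resp eq
    (Reducible-⊕ (Reducible-g⊗mono i β β≤D)
      (Reducible-⊕ (Reducible-scale (a i) xβ-red)
        (Reducible-⊕ (Reducible-scale (b i) xβ-red)
          (Reducible-scale (- 1#) (Reducible-scale (a i) (Reducible-scale (b i) β-red))))))
    where
    x = var i
    M = mono β
    eq : mono (unit i ⊞ (unit i ⊞ β)) ≋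
         g i ⊗ M ⊕ (A i ⊗ mono (unit i ⊞ β) ⊕ (B i ⊗ mono (unit i ⊞ β) ⊕ N ⊗ (A i ⊗ (B i ⊗ M))))
    eq = begin
      mono (unit i ⊞ (unit i ⊞ β))
        ≈⟨ ≋-trans (mono-⊞ (unit i) (unit i ⊞ β)) (⊗-congˡ (mono-⊞ (unit i) β)) ⟩
      x ⊗ (x ⊗ M)
        ≈⟨ ≋-trans (⊕-congˡ (⊗-zeroˡ _)) (≋-trans (⊕-identityʳ _) (≋-trans (⊕-congˡ (⊗-zeroˡ _)) (⊕-identityʳ _))) ⟨
      x ⊗ (x ⊗ M) ⊕ [] ⊗ (x ⊗ M) ⊕ [] ⊗ (x ⊗ M ⊕ N ⊗ (B i ⊗ M))
        ≈⟨ ⊕-cong (⊕-congˡ (⊗-congʳ (q+Nq≋0 (B i)))) (⊗-congʳ (q+Nq≋0 (A i))) ⟨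
      -- The two inserted zeros are (b - b) x M and (a - a) (x M - b M): they supply the terms in
      -- which x² M differs from (x - a) (x - b) M together with their negatives.
      x ⊗ (x ⊗ M) ⊕ (B i ⊕ N ⊗ B i) ⊗ (x ⊗ M) ⊕ (A i ⊕ N ⊗ A i) ⊗ (x ⊗ M ⊕ N ⊗ (B i ⊗ M))
        ≈⟨ P.solve 5 (λ x m a b n →
             x P.:* (x P.:* m) P.:+ (b P.:+ n P.:* b) P.:* (x P.:* m)
               P.:+ (a P.:+ n P.:* a) P.:* (x P.:* m P.:+ n P.:* (b P.:* m))
             P.:= (x P.:+ n P.:* a) P.:* (x P.:+ n P.:* b) P.:* m
               P.:+ (a P.:* (x P.:* m) P.:+ (b P.:* (x P.:* m) P.:+ n P.:* (a P.:* (b P.:* m)))))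
             ≋-refl x M (A i) (B i) N ⟩
      (x ⊕ N ⊗ A i) ⊗ (x ⊕ N ⊗ B i) ⊗ M ⊕ (A i ⊗ (x ⊗ M) ⊕ (B i ⊗ (x ⊗ M) ⊕ N ⊗ (A i ⊗ (B i ⊗ M))))
        ≈⟨ ⊕-cong (⊗-congʳ (g≋ i)) (⊕-cong (⊗-congˡ (mono-⊞ (unit i) β)) (⊕-congʳ (⊗-congˡ (mono-⊞ (unit i) β)))) ⟨
      g i ⊗ M ⊕ (A i ⊗ mono (unit i ⊞ β) ⊕ (B i ⊗ mono (unit i ⊞ β) ⊕ N ⊗ (A i ⊗ (B i ⊗ M)))) ∎

  twice : ∀ (α : Exponent n) i → 2 ℕ.≤ lookup α i → ∃[ β ] α ≡ unit i ⊞ (unit i ⊞ β)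
  twice α i 2≤ with lookup α i in eq
  twice α i (ℕ.s≤s (ℕ.s≤s _)) | suc (suc k) = _ , ≡.trans (unit⊞[]≔ α i eq)
    (≡.cong (unit i ⊞_) (unit⊞[]≔ (α [ i ]≔ suc k) i (Vec.lookup∘update i α (suc k))))

  -- Replacing a square leaves, besides a multiple of some `g i`, only monomials of degree smaller
  -- by one and by two, so the recursion runs on the degree bound `k`. It ends at multilinear
  -- monomials.
  Reducible-mono : ∀ k α → ∣ α ∣ ℕ.≤ k → k ℕ.≤ D → Reducible (mono α)
  Reducible-mono k α α≤k k≤D with any? (λ i → 2 ℕ.≤? lookup α i)
  ... | no  ¬big = reduction Negligible-0
    (≋-trans (multilinear-interpolation α λ i → ℕ.≤-pred (ℕ.≰⇒> λ big → ¬big (i , big))) (≋-sym (⊕-identityˡ _)))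
  ... | yes (i , big) with β , ≡.refl ← twice α i big =
    square k k≤D (≡.subst (ℕ._≤ k) (≡.trans (∣unit⊞∣ i (unit i ⊞ β)) (≡.cong suc (∣unit⊞∣ i β))) α≤k)
    where
    square : ∀ k → k ℕ.≤ D → 2 ℕ.+ ∣ β ∣ ℕ.≤ k → Reducible (mono (unit i ⊞ (unit i ⊞ β)))
    square (suc k) k<D (ℕ.s≤s β<k) = Reducible-square i β (ℕ.≤-trans (ℕ.s≤s β<k) k<D)
      (Reducible-mono k (unit i ⊞ β) (≡.subst (ℕ._≤ k) (≡.sym (∣unit⊞∣ i β)) β<k) (ℕ.<⇒≤ k<D))
      (Reducible-mono k β (ℕ.<⇒≤ β<k) (ℕ.<⇒≤ k<D))

  HasDegree⇒Reducible : ∀ {f} → HasDegree D f → Reducible f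
  HasDegree⇒Reducible (f′ , f≋f′ , bounded) = Reducible-resp f≋f′ (terms bounded)
    where
    terms : ∀ {h} → Bounded D h → Reducible h
    terms []                             = Reducible-0
    terms {(c , α) ∷ h} (α≤D ∷ bounded)  = Reducible-resp (∷≋ c α h)
      (Reducible-⊕ (Reducible-scale c (Reducible-mono D α α≤D ℕ.≤-refl)) (terms bounded))

  -- Membership of the multiples of δᵥ in the cone.

  facets : Vec Bool n → List Constraint
  facets v = List.tabulate λ i → facet i (lookup v i)

  -- The inverse of the volume of the box.
  totalScale : ℝ
  totalScale = product scale

  Πᶜ-tabulate : ∀ {k} (F : Vector Constraint k) → Πᶜ (List.tabulate F) ≋ ⨂ (constraint ∘ F)
  Πᶜ-tabulate {zero}  F = ≋-refl
  Πᶜ-tabulate {suc k} F = ⊗-congˡ (Πᶜ-tabulate (F ∘ suc))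

  weights-tabulate : ∀ {k} (F : Vector Constraint k) → (∀ i → weight (F i) ≡ 1) → weights (List.tabulate F) ≡ k
  weights-tabulate {zero}  F eq = ≡.refl
  weights-tabulate {suc k} F eq = ≡.cong₂ ℕ._+_ (eq zero) (weights-tabulate (F ∘ suc) (eq ∘ suc))

  weights-facets : ∀ v → weights (facets v) ≡ n
  weights-facets v = weights-tabulate _ λ i → weight-facet i (lookup v i)
    where
    weight-facet : ∀ i t → weight (facet i t) ≡ 1
    weight-facet i false = ≡.refl
    weight-facet i true  = ≡.refl

  length-facets : ∀ v → length (facets v) ≡ n
  length-facets v = List.length-tabulate _

  -- Moving the normalising constants to the front leaves a pure product of `n` constraints, as a
  -- `Term` requires.
  basis≋ : ∀ v → basis v ≋ const totalScale ⊗ Πᶜ (facets v)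
  basis≋ v = ≋-trans
    (PolyCube.product-* (const ∘ scale) (λ i → constraint (facet i (lookup v i))))
    (⊗-cong (≋-sym (const-product scale)) (≋-sym (Πᶜ-tabulate λ i → facet i (lookup v i))))

  HasDegree-basis : ∀ v → HasDegree n (basis v)
  HasDegree-basis v = HasDegree-resp (basis≋ v)
    (≡.subst (λ e → HasDegree e (const totalScale ⊗ Πᶜ (facets v))) (weights-facets v)
      (HasDegree-⊗ (HasDegree-const totalScale) (HasDegree-Πᶜ (facets v))))

  totalScale≥0 : 0# ≤ totalScale
  totalScale≥0 = product-nonNeg scale≥0

  Cone-basis : ∀ v {c} → 0# ≤ c → Cone (const c ⊗ basis v)
  Cone-basis v {c} 0≤c = Cone-resp eq
    (Cone-term (facets v) (*-nonNeg 0≤c totalScale≥0)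
      (≡.subst (ℕ._≤ suc D) (≡.sym (length-facets v)) (ℕ.m≤n⇒m≤1+n (ℕ.m≤m+n n d)))
      (≡.subst (ℕ._≤ D) (≡.sym (weights-facets v)) (ℕ.m≤m+n n d)))
    where
    eq : const c ⊗ basis v ≋ const (c * totalScale) ⊗ Πᶜ (facets v)
    eq = begin
      const c ⊗ basis v                                ≈⟨ ⊗-congˡ (basis≋ v) ⟩
      const c ⊗ (const totalScale ⊗ Πᶜ (facets v))     ≈⟨ ⊗-assoc (const c) (const totalScale) (Πᶜ (facets v)) ⟨
      const c ⊗ const totalScale ⊗ Πᶜ (facets v)       ≈⟨ ⊗-congʳ (const-* c totalScale) ⟨
      const (c * totalScale) ⊗ Πᶜ (facets v)           ∎

  Cone-basis⊗p : ∀ v i {c} → 0# ≤ c → Cone (const c ⊗ (basis v ⊗ p i))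
  Cone-basis⊗p v i {c} 0≤c = Cone-resp eq
    (Cone-term (given i ∷ facets v) (*-nonNeg 0≤c totalScale≥0)
      -- There are n + 1 factors, which is exactly `suc D` when `d` is 0; their total weight is
      -- exactly `D`.
      (ℕ.s≤s (≡.subst (ℕ._≤ D) (≡.sym (length-facets v)) (ℕ.m≤m+n n d)))
      (ℕ.≤-reflexive (≡.trans (≡.cong (d ℕ.+_) (weights-facets v)) (ℕ.+-comm d n))))
    where
    eq : const c ⊗ (basis v ⊗ p i) ≋ const (c * totalScale) ⊗ (p i ⊗ Πᶜ (facets v))
    eq = begin
      const c ⊗ (basis v ⊗ p i)                                   ≈⟨ ⊗-congˡ (⊗-congʳ (basis≋ v)) ⟩
      const c ⊗ (const totalScale ⊗ Πᶜ (facets v) ⊗ p i)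
        ≈⟨ P.solve 4 (λ c w l q → c P.:* (w P.:* l P.:* q) P.:= c P.:* w P.:* (q P.:* l)) ≋-refl (const c) (const totalScale) (Πᶜ (facets v)) (p i) ⟩
      const c ⊗ const totalScale ⊗ (p i ⊗ Πᶜ (facets v))          ≈⟨ ⊗-congʳ (const-* c totalScale) ⟨
      const (c * totalScale) ⊗ (p i ⊗ Πᶜ (facets v))              ∎

  -- Modulo negligible polynomials, e δᵥ is (e / pᵢ(v)) δᵥ pᵢ.
  Cone-infeasible : ∀ v i {e} → ¬ 0# ≤ e → ¬ 0# ≤ eval (p i) (vertex v) → Cone (const e ⊗ basis v)
  Cone-infeasible v i {e} e<0 y<0 = Cone-resp eq (Cone-⊕ (Cone-basis⊗p v i c≥0) (negligible (- 1#)))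
    where
    y = eval (p i) (vertex v)

    y≉0 : ¬ (y ≈ 0#)
    y≉0 y≈0 = y<0 (≤-reflexive (sym y≈0))

    z = proj₁ (inverse y≉0)

    zy≈1 : z * y ≈ 1#
    zy≈1 = proj₁ (proj₂ (inverse y≉0))

    -- The quotient of the two negative numbers `e` and `y`, hence nonnegative.
    c = e * z

    c≥0 : 0# ≤ c
    c≥0 = *-nonPos (≰⇒0≤- e<0) (inverse-nonNeg (trans (-x*-y≈x*y z y) zy≈1) (≰⇒0≤- y<0))

    h : Poly n
    h = const c ⊗ (basis v ⊗ p i)

    -- Here `f≋` decomposes `h` as `remainder ⊕ interpolant h`. Its interpolant is e δᵥ, and the
    -- remainder can be subtracted because negative multiples of negligible polynomials lie in the
    -- cone as well.
    open Reducible (HasDegree⇒Reducible {h}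
      (HasDegree-⊗ (HasDegree-const c) (HasDegree-⊗ (HasDegree-basis v) (Degree≤⇒HasDegree (deg-p i)))))

    eval-h : ∀ x → eval h x ≈ c * (eval (basis v) x * eval (p i) x)
    eval-h x = trans (eval-⊗ (const c) (basis v ⊗ p i) x) (*-cong (eval-const c x) (eval-⊗ (basis v) (p i) x))

    interpolant-h : interpolant h ≋ const e ⊗ basis v
    interpolant-h = ≋-trans
      (cubeSum-single n _ v λ u u≢v → ≋-trans (⊗-congʳ (≋-trans (const-cong (trans (eval-h (vertex u))
        (*-zero c (trans (*-congʳ (eval-basis-≢ u v u≢v)) (zeroˡ _))))) const-0)) (⊗-zeroˡ (basis u)))
      (⊗-congʳ (const-cong (trans (eval-h (vertex v))
        (trans (*-congˡ (trans (*-congʳ (eval-basis-≡ v)) (*-identityˡ y)))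
          (trans (*-assoc e z y) (trans (*-congˡ zy≈1) (*-identityʳ e)))))))

    eq : const e ⊗ basis v ≋ h ⊕ N ⊗ remainder
    eq = begin
      const e ⊗ basis v                                      ≈⟨ ⊕-identityˡ _ ⟨
      [] ⊕ const e ⊗ basis v                                 ≈⟨ ⊕-congʳ (q+Nq≋0 remainder) ⟨
      (remainder ⊕ N ⊗ remainder) ⊕ const e ⊗ basis v
        ≈⟨ P.solve 3 (λ r s e → (r P.:+ s) P.:+ e P.:= (r P.:+ e) P.:+ s) ≋-refl remainder (N ⊗ remainder) (const e ⊗ basis v) ⟩
      (remainder ⊕ const e ⊗ basis v) ⊕ N ⊗ remainder        ≈⟨ ⊕-congʳ (⊕-congˡ interpolant-h) ⟨
      (remainder ⊕ interpolant h) ⊕ N ⊗ remainder            ≈⟨ ⊕-congʳ f≋ ⟨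
      h ⊕ N ⊗ remainder                                      ∎

  nonNegative⇒Cone : ∀ {f} → HasDegree D f → (∀ x → x ∈ ConstrainedHypercube → 0# ≤ eval f x) → Cone f
  nonNegative⇒Cone {f} deg-f f≥0 = Cone-resp f≋ (Cone-⊕ (Negligible⇒Cone negligible) (Cone-cubeSum n atVertex))
    where
    open Reducible (HasDegree⇒Reducible deg-f)

    atVertex : ∀ v → Cone (const (eval f (vertex v)) ⊗ basis v)
    atVertex v with 0# ≤? eval f (vertex v)
    ... | yes fv≥0 = Cone-basis v fv≥0
    -- All `g j` vanish at the vertex, so a negative value of `f` forces some `p i` to be negative
    -- there; decidability of the order produces the index.
    ... | no  fv<0
      with i , pᵢv<0 ← ¬∀⟶∃¬ m _ (λ i → 0# ≤? eval (p i) (vertex v))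
                         (λ p≥0 → fv<0 (f≥0 (vertex v) ((λ j → eval-g j v) , p≥0)))
      = Cone-infeasible v i fv<0 pᵢv<0

  -- From the cone to a certificate.

  pad : ∀ q → List Constraint → Vector Constraint q
  pad q       []      = λ _ → one
  pad zero    (c ∷ l) = λ ()
  pad (suc q) (c ∷ l) = c Vector.∷ pad q l

  -- A certificate has the same number of factors in all its products, so short lists are filled up
  -- with `one`, which changes no product. Lists longer than `q` would be cut, hence the bound on
  -- the length.
  productᴾ-pad : ∀ q l → length l ℕ.≤ q → productᴾ (λ i → constraint (pad q l i)) ≋ Πᶜ l
  productᴾ-pad zero    []      _             = ≋-refl
  productᴾ-pad (suc q) []      len           = ≋-trans (*ᴾ≋⊗ (const 1#) _)
    (≋-trans (⊗-identityˡ _) (productᴾ-pad q [] ℕ.z≤n))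
  productᴾ-pad (suc q) (c ∷ l) (ℕ.s≤s len) = ≋-trans (*ᴾ≋⊗ (constraint c) _)
    (⊗-congˡ (productᴾ-pad q l len))

  -- The constant is `c` times the monomial square 1. Having `c` as the weight covers `c = 0` too,
  -- whereas monomial squares have positive coefficients.
  IsSONC-const : ∀ {c} → 0# ≤ c → IsSONC (const {n} c)
  IsSONC-const {c} 0≤c =
    1 , (λ _ → c) , (λ _ → const 1#) , (λ _ → 0≤c) ,
    (λ _ → inj₂ (1# , 𝟎 , 0<1 , (λ i → ≡.subst (2 ∣_) (≡.sym (Vec.lookup-replicate i 0)) (2 ∣0)) , λ _ → refl)) ,
    ≋⇒≈ᴾ (≋-sym (≋-trans (+ᴾ≋⊕ (const c *ᴾ const 1#) []) (≋-trans (⊕-identityʳ _)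
      (≋-trans (*ᴾ≋⊗ (const c) (const 1#)) (⊗-identityʳ (const c))))))

  certificate : ∀ f → Degree≤ D f → (∀ x → x ∈ ConstrainedHypercube → 0# ≤ eval f x) → SONCCertificate D f
  certificate f deg-f f≥0 with ts , f≋ ← nonNegative⇒Cone (Degree≤⇒HasDegree deg-f) f≥0 = record
    -- The bound `length≤` common to all terms.
    { q              = suc D
    ; q≥1            = ℕ.s≤s ℕ.z≤n
    ; k              = length ts
    ; s              = λ t → const (coefficient (List.lookup ts t))
    ; s-SONC         = λ t → IsSONC-const (nonNeg (List.lookup ts t))
    ; factors        = λ t → pad (suc D) (factors (List.lookup ts t))
    ; f≈             = ≋⇒≈ᴾ f≋sum
    ; degree-sum     = HasDegree⇒Degree≤ (HasDegree-resp (≋-sym f≋sum) (Degree≤⇒HasDegree deg-f))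
    ; degree-summand = λ t → HasDegree⇒Degree≤ (HasDegree-resp (summand≋ (List.lookup ts t))
        (HasDegree-≤ (weights≤ (List.lookup ts t))
          (HasDegree-⊗ (HasDegree-const (coefficient (List.lookup ts t))) (HasDegree-Πᶜ (factors (List.lookup ts t))))))
    }
    where
    open Term

    summandOf : Term → Poly n
    summandOf t = const (coefficient t) *ᴾ productᴾ (λ l → constraint (pad (suc D) (factors t) l))

    summand≋ : ∀ t → summandOf t ≋ value t
    summand≋ t = ≋-trans (*ᴾ≋⊗ (const (coefficient t)) _) (⊗-congˡ (productᴾ-pad (suc D) (factors t) (length≤ t)))

    sum≋ : ∀ ts → sumᴾ (λ t → summandOf (List.lookup ts t)) ≋ values ts
    sum≋ []       = ≋-refl
    sum≋ (t ∷ ts) = ≋-trans (+ᴾ≋⊕ (summandOf t) _) (⊕-cong (summand≋ t) (sum≋ ts))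

    f≋sum : f ≋ sumᴾ (λ t → summandOf (List.lookup ts t))
    f≋sum = ≋-trans f≋ (≋-sym (sum≋ ts))

corollary4p8 : (R : RealField) →
    let open RealField R
        open SONC R
    in
    (n d m : ℕ) → 1 ℕ.≤ n →
    (a b : Vector ℝ n) → (∀ j → a j < b j) →
    (p : Vector (Poly n) m) → (∀ i → Degree≤ d (p i)) →
    let open Hypercube a b p in
    (f : Poly n) → Degree≤ (n ℕ.+ d) f →
    (∀ x → x ∈ ConstrainedHypercube → 0# ≤ eval f x) →
    SONCCertificate (n ℕ.+ d) f
corollary4p8 R n d m _ a b a<b p deg-p f deg-f f≥0 = Certificates.certificate R d a b a<b p deg-p f deg-f f≥0
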